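{- Let $x\in[0,1]$ and assume that the base-$2$ expansion $w(x,2)\in\{0,1\}^\omega$ of $x$ is a pure morphic word. Then $x$ satisfies the $2$-adic Littlewood conjecture, i.e. $\liminf_{q\to\infty} q\cdot|q|_2\cdot\|qx\|=0$.
   Context: Here $q$ runs over the positive integers, $|\cdot|_2$ is the $2$-adic absolute value and $\|\cdot\|$ is the distance to the nearest integer. The base-$2$ expansion of $x\in[0,1]$ is the infinite word $w(x,2)=a_1a_2\cdots$ on $\{0,1\}$ with $x=\sum_{i\ge1}a_i2^{ -i}$; it is unique unless $x$ is a rational number with denominator a power of $2$ (rational numbers trivially satisfy the conjecture). $\mathcal{A}^*$ is the set of finite words over a finite alphabet $\mathcal{A}$, including the empty word $\epsilon$. Given a morphism $\phi:\mathcal{A}\to\mathcal{A}^*$ (extended to words by concatenation), a letter $c$ is mortal if $\phi^j(c)=\epsilon$ for some $j\ge1$; $M_\phi$ is the set of mortal letters. The morphism $\phi$ is prolongable on $a\in\mathcal{A}$ if $\phi(a)=ay$ with $y\notin M_\phi^*$. In this case $a,\phi(a),\phi^2(a),\ldots$ converge to the infinite word $\phi^\omega(a)=ay\,\phi(y)\,\phi^2(y)\cdots$; words of this form are called pure morphic words. For a pure morphic word in $\{0,1\}^\omega$ the morphism is $\phi:\{0,1\}\to\{0,1\}^*$. -}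

module Defs where

open import Data.Bool.Base using (if_then_else_)
open import Data.Fin.Base using (Fin; toℕ)
open import Data.Integer.Base as ℤ using (+_)
import Data.Integer.DivMod as ℤ
import Data.Integer.Properties as ℤ
open import Data.List.Base using (List; []; _∷_; concatMap; take; applyUpTo)
open import Data.List.Relation.Unary.All using (All)
open import Data.Nat.Base as ℕ using (ℕ; zero; suc; NonZero)
open import Data.Nat.Divisibility using (_∣?_)
open import Data.Nat.GeneralisedArithmetic using (iterate)
import Data.Nat.Properties as ℕ
open import Data.Product.Base using (∃; ∃₂; ∃-syntax; _×_; _,_)
open import Data.Rational.Base as ℚ using (ℚ; 0ℚ; 1ℚ; ½; ↥_; ↧_; floor)
import Data.Rational.Properties as ℚ
open import Data.Rational.Solver using (module +-*-Solver)
import Data.Rational.Unnormalised.Base as ℚᵘ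
import Data.Rational.Unnormalised.Properties as ℚᵘ
open import Data.Sum.Base using (_⊎_; inj₁; inj₂)
open import Relation.Binary.PropositionalEquality
  using (_≡_; refl; sym; trans; cong; cong₂; subst; subst₂)
open import Relation.Nullary using (¬_; yes; no; does)

Word : ℕ → Set
Word k = List (Fin k)

ωWord : ℕ → Set
ωWord k = ℕ → Fin k

Morphism : ℕ → Set
Morphism k = Fin k → Word k

module _ {k : ℕ} (φ : Morphism k) where

  -- φ^j(u), with φ extended to words by concatenation.
  power : ℕ → Word k → Word k
  power j u = iterate (concatMap φ) u j

  Mortal : Fin k → Set
  Mortal c = ∃[ j ] (1 ℕ.≤ j × power j (c ∷ []) ≡ [])

  Prolongable : Fin k → Set
  Prolongable a = ∃[ y ] (φ a ≡ a ∷ y × ¬ All Mortal y)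

-- Finite words converge to an infinite word when every prefix of the
-- limit is eventually a prefix of the terms (the right-hand side has
-- length m, so the terms are in particular eventually of length ≥ m).
_⟶ʷ_ : ∀ {k} → (ℕ → Word k) → ωWord k → Set
u ⟶ʷ w = ∀ m → ∃[ N ] (∀ n → N ℕ.≤ n → take m (u n) ≡ applyUpTo w m)

-- w = φ^ω(a), for some φ prolongable on a, over the same alphabet as w.
PureMorphic : ∀ {k} → ωWord k → Set
PureMorphic {k} w = ∃₂ λ (φ : Morphism k) (a : Fin k) →
  Prolongable φ a × ((λ n → power φ n (a ∷ [])) ⟶ʷ w)

-- The smaller of the distances from r to ⌊r⌋ and to ⌊r⌋ + 1; by distℤ-≤ and
-- distℤ-attained this is the distance from r to the nearest integer.
distℤ : ℚ → ℚ
distℤ r = (r ℚ.- floor r ℚ./ 1) ℚ.⊓ (1ℚ ℚ.- (r ℚ.- floor r ℚ./ 1))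

private
  open +-*-Solver

  ∣∣≤ : ∀ {p b} → p ℚ.≤ b → ℚ.- p ℚ.≤ b → ℚ.∣ p ∣ ℚ.≤ b
  ∣∣≤ {p} p≤b -p≤b with ℚ.∣p∣≡p∨∣p∣≡-p p
  ... | inj₁ e = ℚ.≤-trans (ℚ.≤-reflexive e) p≤b
  ... | inj₂ e = ℚ.≤-trans (ℚ.≤-reflexive e) -p≤b

  p≤∣p∣ : ∀ p → p ℚ.≤ ℚ.∣ p ∣
  p≤∣p∣ p with ℚ.≤-total 0ℚ p
  ... | inj₁ 0≤p = ℚ.≤-reflexive (sym (ℚ.0≤p⇒∣p∣≡p 0≤p))
  ... | inj₂ p≤0 = ℚ.≤-trans p≤0 (ℚ.0≤∣p∣ p)

  -p≤∣p∣ : ∀ p → ℚ.- p ℚ.≤ ℚ.∣ p ∣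
  -p≤∣p∣ p = subst (ℚ.- p ℚ.≤_) (ℚ.∣-p∣≡∣p∣ p) (p≤∣p∣ (ℚ.- p))

  ∣-∣-sym : ∀ p q → ℚ.∣ p ℚ.- q ∣ ≡ ℚ.∣ q ℚ.- p ∣
  ∣-∣-sym p q = trans (sym (ℚ.∣-p∣≡∣p∣ (p ℚ.- q)))
    (cong ℚ.∣_∣ (solve 2 (λ p q → :- (p :- q) := q :- p) refl p q))

  twoSided : (f : ℚ → ℚ) → (∀ r s → f r ℚ.≤ f s ℚ.+ ℚ.∣ r ℚ.- s ∣) →
             ∀ r s → ℚ.∣ f r ℚ.- f s ∣ ℚ.≤ 1ℚ ℚ.* ℚ.∣ r ℚ.- s ∣
  twoSided f h r s = ℚ.≤-trans
    (∣∣≤ (side r s)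
         (subst₂ ℚ._≤_
           (solve 2 (λ a b → b :- a := :- (a :- b)) refl (f r) (f s))
           (∣-∣-sym s r)
           (side s r)))
    (ℚ.≤-reflexive (sym (ℚ.*-identityˡ _)))
    where
    side : ∀ r s → f r ℚ.- f s ℚ.≤ ℚ.∣ r ℚ.- s ∣
    side r s = subst (f r ℚ.- f s ℚ.≤_)
      (solve 2 (λ b d → b :+ d :- b := d) refl (f s) ℚ.∣ r ℚ.- s ∣)
      (ℚ.+-monoˡ-≤ (ℚ.- f s) (h r s))

  ∣∣-step : ∀ r s → ℚ.∣ r ∣ ℚ.≤ ℚ.∣ s ∣ ℚ.+ ℚ.∣ r ℚ.- s ∣
  ∣∣-step r s = subst (λ z → ℚ.∣ z ∣ ℚ.≤ ℚ.∣ s ∣ ℚ.+ ℚ.∣ r ℚ.- s ∣)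
    (solve 2 (λ r s → s :+ (r :- s) := r) refl r s)
    (ℚ.∣p+q∣≤∣p∣+∣q∣ s (r ℚ.- s))

  toℚᵘ-/1 : ∀ i → ℚ.toℚᵘ (i ℚ./ 1) ℚᵘ.≃ ℚᵘ.mkℚᵘ i 0
  toℚᵘ-/1 i = ℚ.toℚᵘ-fromℚᵘ (ℚᵘ.mkℚᵘ i 0)

  /1-mono : ∀ {i j} → i ℤ.≤ j → i ℚ./ 1 ℚ.≤ j ℚ./ 1
  /1-mono {i} {j} i≤j = ℚ.toℚᵘ-cancel-≤
    (ℚᵘ.≤-respˡ-≃ (ℚᵘ.≃-sym (toℚᵘ-/1 i)) (ℚᵘ.≤-respʳ-≃ (ℚᵘ.≃-sym (toℚᵘ-/1 j))
      (ℚᵘ.*≤* (ℤ.*-monoʳ-≤-nonNeg (+ 1) i≤j))))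

  /1-suc : ∀ i → ℤ.suc i ℚ./ 1 ≡ 1ℚ ℚ.+ i ℚ./ 1
  /1-suc i = ℚ.toℚᵘ-injective (ℚᵘ.≃-trans (toℚᵘ-/1 (ℤ.suc i))
    (ℚᵘ.≃-sym (ℚᵘ.≃-trans (ℚ.toℚᵘ-homo-+ 1ℚ (i ℚ./ 1))
      (ℚᵘ.≃-trans (ℚᵘ.+-congʳ ℚᵘ.1ℚᵘ (toℚᵘ-/1 i))
        (ℚᵘ.*≡* (cong (ℤ._* + 1) (cong (λ z → (+ 1) ℤ.+ z) (ℤ.*-identityʳ i))))))))

  floor≤ : ∀ r → floor r ℚ./ 1 ℚ.≤ r
  floor≤ r@record{} = ℚ.toℚᵘ-cancel-≤
    (ℚᵘ.≤-respˡ-≃ (ℚᵘ.≃-sym (toℚᵘ-/1 (floor r)))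
      (ℚᵘ.*≤* (ℤ.≤-trans (ℤ.[n/d]*d≤n (↥ r) (↧ r))
                (ℤ.≤-reflexive (sym (ℤ.*-identityʳ (↥ r)))))))

  ≤floor+1 : ∀ r → r ℚ.≤ ℤ.suc (floor r) ℚ./ 1
  ≤floor+1 r@record{} = ℚ.toℚᵘ-cancel-≤
    (ℚᵘ.≤-respʳ-≃ (ℚᵘ.≃-sym (toℚᵘ-/1 (ℤ.suc (floor r))))
      (ℚᵘ.*≤* (ℤ.≤-trans (ℤ.≤-reflexive (ℤ.*-identityʳ (↥ r)))
        (ℤ.<⇒≤ (subst (λ z → ↥ r ℤ.< ℤ.suc z ℤ.* ↧ r)
          (sym (ℤ.div-pos-is-/ℕ (↥ r) (ℚ.↧ₙ r)))
          (ℤ.n<s[n/ℕd]*d (↥ r) (ℚ.↧ₙ r)))))))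

  up-eq : ∀ r → ℤ.suc (floor r) ℚ./ 1 ℚ.- r ≡ 1ℚ ℚ.- (r ℚ.- floor r ℚ./ 1)
  up-eq r = trans (cong (ℚ._- r) (/1-suc (floor r)))
    (solve 3 (λ o f r → o :+ f :- r := o :- (r :- f)) refl 1ℚ (floor r ℚ./ 1) r)

  0≤sub : ∀ {p q} → p ℚ.≤ q → 0ℚ ℚ.≤ q ℚ.- p
  0≤sub {p} {q} p≤q = subst (ℚ._≤ q ℚ.- p) (ℚ.+-inverseʳ p) (ℚ.+-monoˡ-≤ (ℚ.- p) p≤q)

distℤ-≤ : ∀ r n → distℤ r ℚ.≤ ℚ.∣ r ℚ.- n ℚ./ 1 ∣
distℤ-≤ r n with n ℤ.≤? floor r
... | yes n≤f = ℚ.≤-trans (ℚ.p⊓q≤p _ _)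
        (ℚ.≤-trans (ℚ.+-monoʳ-≤ r (ℚ.neg-antimono-≤ (/1-mono n≤f))) (p≤∣p∣ _))
... | no n≰f = ℚ.≤-trans (ℚ.p⊓q≤q (r ℚ.- floor r ℚ./ 1) _)
        (ℚ.≤-trans (ℚ.≤-reflexive (sym (up-eq r)))
        (ℚ.≤-trans (ℚ.+-monoˡ-≤ (ℚ.- r) (/1-mono (ℤ.i<j⇒suc[i]≤j (ℤ.≰⇒> n≰f))))
        (subst (n ℚ./ 1 ℚ.- r ℚ.≤_) (∣-∣-sym (n ℚ./ 1) r) (p≤∣p∣ _))))

distℤ-attained : ∀ r → ∃[ n ] distℤ r ≡ ℚ.∣ r ℚ.- n ℚ./ 1 ∣
distℤ-attained r with ℚ.⊓-sel (r ℚ.- floor r ℚ./ 1) (1ℚ ℚ.- (r ℚ.- floor r ℚ./ 1))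
... | inj₁ e = floor r , trans e (sym (ℚ.0≤p⇒∣p∣≡p (0≤sub (floor≤ r))))
... | inj₂ e = ℤ.suc (floor r) , trans e (trans (sym (up-eq r))
        (trans (sym (ℚ.0≤p⇒∣p∣≡p (0≤sub (≤floor+1 r)))) (∣-∣-sym _ r)))

private
  distℤ-step : ∀ r s → distℤ r ℚ.≤ distℤ s ℚ.+ ℚ.∣ r ℚ.- s ∣
  distℤ-step r s with distℤ-attained s
  ... | n , e = ℚ.≤-trans (distℤ-≤ r n) (subst₂ ℚ._≤_
    (cong ℚ.∣_∣ (solve 3 (λ r s n → s :- n :+ (r :- s) := r :- n) refl r s (n ℚ./ 1)))
    (cong (ℚ._+ ℚ.∣ r ℚ.- s ∣) (sym e))
    (ℚ.∣p+q∣≤∣p∣+∣q∣ (s ℚ.- n ℚ./ 1) (r ℚ.- s)))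

-- A Cauchy sequence of rationals, with modulus; distinct sequences may
-- represent the same real.
record ℝ : Set where
  constructor mkℝ
  field
    seq    : ℕ → ℚ
    cauchy : ∀ ε → 0ℚ ℚ.< ε →
             ∃[ N ] (∀ m n → N ℕ.≤ m → N ℕ.≤ n → ℚ.∣ seq m ℚ.- seq n ∣ ℚ.< ε)

open ℝ public

infix 4 _<_ _≤_

_<_ : ℝ → ℝ → Set
x < y = ∃[ ε ] (0ℚ ℚ.< ε × ∃[ N ] (∀ n → N ℕ.≤ n → seq x n ℚ.+ ε ℚ.≤ seq y n))

_≤_ : ℝ → ℝ → Set
x ≤ y = ¬ (y < x)

fromℚ : ℚ → ℝ
fromℚ c = mkℝ (λ _ → c) λ ε 0<ε →
  0 , λ _ _ _ _ → subst (ℚ._< ε) (sym (cong ℚ.∣_∣ (ℚ.+-inverseʳ c))) 0<ε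

0ℝ 1ℝ : ℝ
0ℝ = fromℚ 0ℚ
1ℝ = fromℚ 1ℚ

lift : (f : ℚ → ℚ) (K : ℚ) .{{_ : ℚ.Positive K}} →
       (∀ r s → ℚ.∣ f r ℚ.- f s ∣ ℚ.≤ K ℚ.* ℚ.∣ r ℚ.- s ∣) → ℝ → ℝ
lift f K lip x = mkℝ (λ n → f (seq x n)) λ ε 0<ε →
  let instance
        K≢0 = ℚ.pos⇒nonZero K
        1/K>0 = ℚ.1/pos⇒pos K
      δ = ℚ.1/ K ℚ.* ε
      0<δ = subst (ℚ._< δ) (ℚ.*-zeroʳ (ℚ.1/ K)) (ℚ.*-monoʳ-<-pos (ℚ.1/ K) 0<ε)
      N , h = cauchy x δ 0<δ
      Kδ≡ε = trans (sym (ℚ.*-assoc K (ℚ.1/ K) ε))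
               (trans (cong (ℚ._* ε) (ℚ.*-inverseʳ K)) (ℚ.*-identityˡ ε))
  in N , λ m n N≤m N≤n → ℚ.≤-<-trans (lip (seq x m) (seq x n))
       (subst (K ℚ.* ℚ.∣ seq x m ℚ.- seq x n ∣ ℚ.<_) Kδ≡ε
         (ℚ.*-monoʳ-<-pos K (h m n N≤m N≤n)))

infixl 6 _+_ _-_
infixr 7 _·_
infix  8 -_

_+_ : ℝ → ℝ → ℝ
x + y = mkℝ (λ n → seq x n ℚ.+ seq y n) λ ε 0<ε →
  let δ = ½ ℚ.* ε
      0<δ = subst (ℚ._< δ) (ℚ.*-zeroʳ ½) (ℚ.*-monoʳ-<-pos ½ 0<ε)
      M , h = cauchy x δ 0<δ
      N , k = cauchy y δ 0<δ
      δ+δ≡ε = trans (sym (ℚ.*-distribʳ-+ ε ½ ½)) (ℚ.*-identityˡ ε)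
  in M ℕ.⊔ N , λ m n p q → subst₂ ℚ._<_
       refl δ+δ≡ε
       (ℚ.≤-<-trans
         (subst (λ z → ℚ.∣ z ∣ ℚ.≤
                   ℚ.∣ seq x m ℚ.- seq x n ∣ ℚ.+ ℚ.∣ seq y m ℚ.- seq y n ∣)
           (solve 4 (λ a b c d → a :- b :+ (c :- d) := a :+ c :- (b :+ d)) refl
             (seq x m) (seq x n) (seq y m) (seq y n))
           (ℚ.∣p+q∣≤∣p∣+∣q∣ (seq x m ℚ.- seq x n) (seq y m ℚ.- seq y n)))
         (ℚ.+-mono-<
           (h m n (ℕ.m⊔n≤o⇒m≤o M N p) (ℕ.m⊔n≤o⇒m≤o M N q))
           (k m n (ℕ.m⊔n≤o⇒n≤o M N p) (ℕ.m⊔n≤o⇒n≤o M N q))))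

_·_ : ℚ → ℝ → ℝ
c · x = lift (c ℚ.*_) (1ℚ ℚ.+ ℚ.∣ c ∣) {{1+∣c∣>0}} lip x
  where
  1+∣c∣>0 : ℚ.Positive (1ℚ ℚ.+ ℚ.∣ c ∣)
  1+∣c∣>0 = ℚ.pos+nonNeg⇒pos 1ℚ ℚ.∣ c ∣ {{ℚ.∣-∣-nonNeg c}}

  lip : ∀ r s → ℚ.∣ c ℚ.* r ℚ.- c ℚ.* s ∣ ℚ.≤ (1ℚ ℚ.+ ℚ.∣ c ∣) ℚ.* ℚ.∣ r ℚ.- s ∣
  lip r s = subst (ℚ._≤ (1ℚ ℚ.+ ℚ.∣ c ∣) ℚ.* ℚ.∣ r ℚ.- s ∣)
    (trans (sym (ℚ.∣p*q∣≡∣p∣*∣q∣ c (r ℚ.- s)))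
      (cong ℚ.∣_∣ (solve 3 (λ c r s → c :* (r :- s) := c :* r :- c :* s) refl c r s)))
    (ℚ.*-monoʳ-≤-nonNeg ℚ.∣ r ℚ.- s ∣ {{ℚ.∣-∣-nonNeg (r ℚ.- s)}}
      (subst (ℚ._≤ 1ℚ ℚ.+ ℚ.∣ c ∣) (ℚ.+-identityˡ ℚ.∣ c ∣)
        (ℚ.+-monoˡ-≤ ℚ.∣ c ∣ (ℚ.nonNegative⁻¹ 1ℚ))))

-_ : ℝ → ℝ
- x = ℚ.- 1ℚ · x

_-_ : ℝ → ℝ → ℝ
x - y = x + - y

∣_∣ : ℝ → ℝ
∣_∣ = lift ℚ.∣_∣ 1ℚ (twoSided ℚ.∣_∣ ∣∣-step)

-- Distance to the nearest integer, extended by continuity from ℚ.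
‖_‖ : ℝ → ℝ
‖_‖ = lift distℤ 1ℚ (twoSided distℤ distℤ-step)

_⟶_ : (ℕ → ℝ) → ℝ → Set
s ⟶ x = ∀ ε → 0ℚ ℚ.< ε → ∃[ N ] (∀ n → N ℕ.≤ n → ∣ s n - x ∣ < fromℚ ε)

IsLiminf : (ℕ → ℝ) → ℝ → Set
IsLiminf s L =
    (∀ ε → 0ℚ ℚ.< ε → ∃[ N ] (∀ n → N ℕ.≤ n → L - fromℚ ε < s n))
  × (∀ ε → 0ℚ ℚ.< ε → ∀ N → ∃[ n ] (N ℕ.≤ n × s n < L + fromℚ ε))

ℕ→ℚ : ℕ → ℚ
ℕ→ℚ q = (+ q) ℚ./ 1

½^_ : ℕ → ℚ
½^ n = ((+ 1) ℚ./ (2 ℕ.^ n)) {{ℕ.m^n≢0 2 n}}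

-- The letter a_i of the word a_1 a_2 ⋯ is w (i - 1).
partialSum : ωWord 2 → ℕ → ℚ
partialSum w zero    = 0ℚ
partialSum w (suc n) = partialSum w n ℚ.+ ℕ→ℚ (toℕ (w n)) ℚ.* (½^ suc n)

-- Dyadic rationals have two expansions; either one is allowed.
_IsBase2ExpansionOf_ : ωWord 2 → ℝ → Set
w IsBase2ExpansionOf x = (λ n → fromℚ (partialSum w n)) ⟶ x

-- The largest v ≤ b such that 2 ^ v divides q.
ν₂≤ : ℕ → ℕ → ℕ
ν₂≤ zero    q = 0
ν₂≤ (suc b) q = if does (2 ℕ.^ suc b ∣? q) then suc b else ν₂≤ b q

-- The bound b = q suffices for q ≥ 1, since 2 ^ v ∣ q implies v < q.
∣_∣₂ : (q : ℕ) .{{_ : NonZero q}} → ℚ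
∣ q ∣₂ = ½^ ν₂≤ q q

littlewoodTerm : ℝ → (q : ℕ) .{{_ : NonZero q}} → ℝ
littlewoodTerm x q = (ℕ→ℚ q ℚ.* ∣ q ∣₂) · ‖ ℕ→ℚ q · x ‖

-- The positive integer q is enumerated as suc n.
SatisfiesTwoAdicLittlewood : ℝ → Set
SatisfiesTwoAdicLittlewood x = IsLiminf (λ n → littlewoodTerm x (suc n)) 0ℝ

{-# OPTIONS --safe #-}
-- If w repeats with period p for p + K letters from position k on, then
-- (2 ^ p - 1) 2 ^ k x lies within 2 ^ (- (p + K)) of an integer, so that q = 2 ^ k (2 ^ p - 1)
-- has q |q|₂ ‖q x‖ ≤ 2 ^ (- K).  If instead each of these letters differs from the one p
-- places further on, then q = 2 ^ k (2 ^ p + 1) does as well, up to a factor 2.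
--
-- An infinite binary word that has no overlap c u c u c desubstitutes under the Thue–Morse
-- morphism μ, away from a prefix, as often as one likes, and so contains μⁿ(c) μⁿ(c̄) μⁿ(c),
-- which is of the second kind with p = K = 2 ^ n.  An overlap c u c u c in a fixed point of φ
-- is mapped by φⁿ to a repetition of the first kind with K = |φⁿ(c)|.  This fails only if
-- |φⁿ(c)| stays bounded, which forces φ(c) = ε or φ(c) = c; then w contains unbounded powers
-- of c, or an overlap that begins with the other letter, the one that φ is prolongable on
-- and whose images therefore grow.
module Submission where

open import Defs
import Algebra.Solver.Monoid
open import Data.Empty using (⊥-elim)
open import Data.Fin.Base using (Fin; zero; suc; toℕ)
open import Data.Fin.Properties using (_≟_)
open import Data.Integer.Base as ℤ using (+_)
import Data.Integer.Properties as ℤ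
open import Data.List.Base
  using ([]; _∷_; _++_; [_]; length; take; drop; applyUpTo; concatMap)
import Data.List.Properties as List
open import Data.List.Relation.Unary.All as All using (All; []; _∷_)
import Data.List.Relation.Unary.All.Properties as All
open import Data.Nat.Base as ℕ using (ℕ; zero; suc; s≤s; z≤n; NonZero)
open import Data.Nat.Divisibility using (_∣_; _∣?_; m∣m*n)
import Data.Nat.Properties as ℕ
open import Data.Nat.Solver using (module +-*-Solver)
open import Data.Product.Base using (∃₂; ∃-syntax; _×_; _,_; proj₂)
open import Data.Rational.Base as ℚ using (ℚ; 0ℚ; 1ℚ; ½; mkℚ)
import Data.Rational.Properties as ℚ
import Data.Rational.Solver as ℚSolver
import Data.Rational.Unnormalised.Base as ℚᵘ
import Data.Rational.Unnormalised.Properties as ℚᵘ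
open import Data.Sum.Base using (_⊎_; inj₁; inj₂; [_,_]′)
open import Data.Unit.Base using (⊤; tt)
open import Function.Base using (_∘_)
open import Relation.Binary.PropositionalEquality
  using (_≡_; _≢_; refl; sym; trans; cong; cong₂; subst; subst₂; module ≡-Reasoning)
open import Relation.Nullary using (¬_; yes; no)

-- Overlaps and desubstitution under μ in binary words.

≢≢⇒≡ : {a b c : Fin 2} → a ≢ b → b ≢ c → a ≡ c
≢≢⇒≡ {zero}     {zero}     {c}        p q = ⊥-elim (p refl)
≢≢⇒≡ {zero}     {suc zero} {zero}     p q = refl
≢≢⇒≡ {zero}     {suc zero} {suc zero} p q = ⊥-elim (q refl)
≢≢⇒≡ {suc zero} {zero}     {zero}     p q = ⊥-elim (q refl)
≢≢⇒≡ {suc zero} {zero}     {suc zero} p q = refl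
≢≢⇒≡ {suc zero} {suc zero} {c}        p q = ⊥-elim (p refl)

-- A record rather than a function type, so that unification recovers the parameters from the type.
record Correlated (R : Fin 2 → Fin 2 → Set) (v : ωWord 2) (k p L : ℕ) : Set where
  field
    at : ∀ i → i ℕ.< L → R (v (i ℕ.+ k)) (v (i ℕ.+ (p ℕ.+ k)))

open Correlated

Agree Differ : ωWord 2 → (k p L : ℕ) → Set
Agree  = Correlated _≡_
Differ = Correlated _≢_

-- A factor c u c u c with |c u| = 1 + p.
Overlap : ωWord 2 → Set
Overlap v = ∃₂ λ k p → Agree v k (suc p) (2 ℕ.+ p)

module _ {R : Fin 2 → Fin 2 → Set} {v : ωWord 2} where

  correlated-[] : ∀ {k p} → Correlated R v k p 0
  correlated-[] .at _ ()

  infixr 5 _∷ᶜ_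
  _∷ᶜ_ : ∀ {k p L} → R (v k) (v (p ℕ.+ k)) → Correlated R v (suc k) p L →
         Correlated R v k p (suc L)
  (r ∷ᶜ rs) .at zero _ = r
  _∷ᶜ_ {k} {p} r rs .at (suc i) (s≤s i<L) = subst₂ (λ m n → R (v m) (v n))
    (ℕ.+-suc i k) (trans (cong (i ℕ.+_) (ℕ.+-suc p k)) (ℕ.+-suc i (p ℕ.+ k)))
    (rs .at i i<L)

  correlated-≤ : ∀ {k p L L′} → L′ ℕ.≤ L → Correlated R v k p L → Correlated R v k p L′
  correlated-≤ L′≤L rs .at i i<L′ = rs .at i (ℕ.<-≤-trans i<L′ L′≤L)

cube : ∀ v n → v n ≡ v (1 ℕ.+ n) → v (1 ℕ.+ n) ≡ v (2 ℕ.+ n) → Overlap v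
cube v n e f = n , 0 , e ∷ᶜ f ∷ᶜ correlated-[]

-- Five letters without equal neighbours read `ababa`. The search starts at position 1 so that the
-- square found has a letter before it, which `blocks-or-overlap` inspects.
square-or-overlap : ∀ v → (∃[ r ] v (1 ℕ.+ r) ≡ v (2 ℕ.+ r)) ⊎ Overlap v
square-or-overlap v with v 1 ≟ v 2 | v 2 ≟ v 3 | v 3 ≟ v 4 | v 4 ≟ v 5
... | yes e | _ | _ | _ = inj₁ (0 , e)
... | no _ | yes e | _ | _ = inj₁ (1 , e)
... | no _ | no _ | yes e | _ = inj₁ (2 , e)
... | no _ | no _ | no _ | yes e = inj₁ (3 , e)
... | no a | no b | no c | no d =
  inj₂ (1 , 1 , ≢≢⇒≡ a b ∷ᶜ ≢≢⇒≡ b c ∷ᶜ ≢≢⇒≡ c d ∷ᶜ correlated-[])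

-- Comparing neighbours across the block boundaries leaves a cube, the word `ababa`, or the word
-- `abbabba` of period 3.
misaligned-square : ∀ v n → v n ≢ v (1 ℕ.+ n) → v (2 ℕ.+ n) ≢ v (3 ℕ.+ n) →
                    v (4 ℕ.+ n) ≡ v (5 ℕ.+ n) → Overlap v
misaligned-square v n 0≢1 2≢3 4≡5 with v (3 ℕ.+ n) ≟ v (4 ℕ.+ n)
... | yes 3≡4 = cube v (3 ℕ.+ n) 3≡4 4≡5
... | no 3≢4 with v (1 ℕ.+ n) ≟ v (2 ℕ.+ n)
...   | no 1≢2 = n , 1 , ≢≢⇒≡ 0≢1 1≢2 ∷ᶜ ≢≢⇒≡ 1≢2 2≢3 ∷ᶜ ≢≢⇒≡ 2≢3 3≢4 ∷ᶜ correlated-[]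
...   | yes 1≡2 with v (5 ℕ.+ n) ≟ v (6 ℕ.+ n)
...     | yes 5≡6 = cube v (4 ℕ.+ n) 4≡5 5≡6
...     | no 5≢6 = n , 2 ,
            ≢≢⇒≡ 0≢1 (λ 1≡3 → 2≢3 (trans (sym 1≡2) 1≡3))
         ∷ᶜ trans 1≡2 2≡4
         ∷ᶜ trans 2≡4 4≡5
         ∷ᶜ ≢≢⇒≡ (λ 3≡5 → 3≢4 (trans 3≡5 (sym 4≡5))) 5≢6
         ∷ᶜ correlated-[]
  where
  2≡4 : v (2 ℕ.+ n) ≡ v (4 ℕ.+ n)
  2≡4 = ≢≢⇒≡ 2≢3 3≢4

-- If u consists of every second letter of v from c on, then v agrees with μ(u) from c on,
-- for M blocks of length 2.
Blocks : ωWord 2 → (c M : ℕ) → Set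
Blocks v c M = ∀ i → i ℕ.< M → v (i ℕ.* 2 ℕ.+ c) ≢ v (1 ℕ.+ (i ℕ.* 2 ℕ.+ c))

-- The blocks are cut through the middle of the square at `1 + r`. The first block that fails is
-- itself a square, and the two unequal pairs before it make `misaligned-square` apply; near the
-- cut, the given square helps out.
blocks-or-overlap : ∀ v r → v (1 ℕ.+ r) ≡ v (2 ℕ.+ r) → ∀ M → Blocks v (2 ℕ.+ r) M ⊎ Overlap v
blocks-or-overlap v r sq zero = inj₁ λ _ ()
blocks-or-overlap v r sq (suc M) with blocks-or-overlap v r sq M
... | inj₂ o = inj₂ o
... | inj₁ b with v (M ℕ.* 2 ℕ.+ (2 ℕ.+ r)) ≟ v (1 ℕ.+ (M ℕ.* 2 ℕ.+ (2 ℕ.+ r)))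
...   | no M≢ = inj₁ λ i i<1+M → [ b i , (λ { refl → M≢ }) ]′ (ℕ.m≤n⇒m<n∨m≡n (ℕ.≤-pred i<1+M))
...   | yes e = inj₂ (odd-square M b e)
  where
  odd-square : ∀ M → Blocks v (2 ℕ.+ r) M →
               v (M ℕ.* 2 ℕ.+ (2 ℕ.+ r)) ≡ v (1 ℕ.+ (M ℕ.* 2 ℕ.+ (2 ℕ.+ r))) → Overlap v
  odd-square 0 b e = cube v (1 ℕ.+ r) sq e
  -- Only one block precedes. The pair at `r` stands in for another, unless it extends the given
  -- square to a cube.
  odd-square 1 b e with v r ≟ v (1 ℕ.+ r)
  ... | yes r≡ = cube v r r≡ sq
  ... | no r≢ = misaligned-square v r r≢ (b 0 (s≤s z≤n)) e
  odd-square (suc (suc m)) b e = misaligned-square v (m ℕ.* 2 ℕ.+ (2 ℕ.+ r))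
    (b m (ℕ.m≤n⇒m≤1+n ℕ.≤-refl)) (b (suc m) ℕ.≤-refl) e

parity : ∀ i → ∃[ j ] (i ≡ j ℕ.* 2 ⊎ i ≡ 1 ℕ.+ j ℕ.* 2)
parity zero = 0 , inj₁ refl
parity (suc i) with parity i
... | j , inj₁ refl = j , inj₂ refl
... | j , inj₂ refl = suc j , inj₁ refl

-- On two letters `a ≢ a′` says that `a′` is the complement of `a`; complementing both arguments is
-- the passage from the first to the second letters of two μ-blocks.
FlipInvariant : (Fin 2 → Fin 2 → Set) → Set
FlipInvariant R = ∀ {a b a′ b′} → a ≢ a′ → b ≢ b′ → R a b → R a′ b′

≡-flip : FlipInvariant _≡_
≡-flip a≢a′ b≢b′ refl = ≢≢⇒≡ (a≢a′ ∘ sym) b≢b′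

≢-flip : FlipInvariant _≢_
≢-flip a≢a′ b≢b′ a≢b a′≡b′ = b≢b′ (trans (sym (≢≢⇒≡ (a≢a′ ∘ sym) a≢b)) a′≡b′)

module _ (v : ωWord 2) (c : ℕ) where

  halve : ωWord 2
  halve i = v (i ℕ.* 2 ℕ.+ c)

  private
    module Indices (k p j : ℕ) where
      open +-*-Solver

      index₁ : (j ℕ.+ k) ℕ.* 2 ℕ.+ c ≡ j ℕ.* 2 ℕ.+ (k ℕ.* 2 ℕ.+ c)
      index₁ = solve 3 (λ j k c →
        (j :+ k) :* con 2 :+ c := j :* con 2 :+ (k :* con 2 :+ c)) refl j k c

      index₂ : (j ℕ.+ (p ℕ.+ k)) ℕ.* 2 ℕ.+ c ≡ j ℕ.* 2 ℕ.+ (p ℕ.* 2 ℕ.+ (k ℕ.* 2 ℕ.+ c))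
      index₂ = solve 4 (λ j p k c → (j :+ (p :+ k)) :* con 2 :+ c :=
        j :* con 2 :+ (p :* con 2 :+ (k :* con 2 :+ c))) refl j p k c

  -- At an even offset from `c` stands a letter of `halve v c`, at an odd offset the complement of
  -- the letter before it. So the correlation passes through μ, with period and length doubled.
  correlated-double : ∀ {R} → FlipInvariant R → ∀ {k p L} → Blocks v c (L ℕ.+ (p ℕ.+ k)) →
    Correlated R halve k p L → Correlated R v (k ℕ.* 2 ℕ.+ c) (p ℕ.* 2) (L ℕ.* 2)
  correlated-double {R} R-flip {k} {p} {L} b rs .at i i<2L with parity i
  ... | j , inj₁ refl = subst₂ (λ m n → R (v m) (v n)) index₁ index₂
                          (rs .at j (ℕ.*-cancelʳ-< 2 j L i<2L))
    where open Indices k p j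
  ... | j , inj₂ refl = subst₂ (λ m n → R (v (suc m)) (v (suc n))) index₁ index₂
      (R-flip (b (j ℕ.+ k) (ℕ.+-mono-<-≤ j<L (ℕ.m≤n+m k p)))
              (b (j ℕ.+ (p ℕ.+ k)) (ℕ.+-monoˡ-< (p ℕ.+ k) j<L)) (rs .at j j<L))
    where
    open Indices k p j
    j<L : j ℕ.< L
    j<L = ℕ.*-cancelʳ-< 2 j L (ℕ.<-trans (ℕ.n<1+n _) i<2L)

-- Induction on `n` for all `v` at once: what is found in `halve v c` is carried back to `v` by
-- doubling.
overlap-or-differ : ∀ n v → Overlap v ⊎ (∃[ k ] Differ v k (2 ℕ.^ n) (2 ℕ.^ n ℕ.* 2))
overlap-or-differ n v with square-or-overlap v
... | inj₂ o = inj₁ o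
... | inj₁ (r , sq) = desubstitute n
  where
  c : ℕ
  c = 2 ℕ.+ r

  overlap-double : Overlap (halve v c) → Overlap v
  overlap-double (k , p , rs) with blocks-or-overlap v r sq (2 ℕ.+ p ℕ.+ (suc p ℕ.+ k))
  ... | inj₂ o = o
  ... | inj₁ b = k ℕ.* 2 ℕ.+ c , suc (p ℕ.* 2) ,
    -- Doubling gives `4 + 2p` comparisons, one more than an overlap of period `2 + 2p` asks for.
    correlated-≤ (ℕ.n≤1+n _) (correlated-double v c ≡-flip b rs)

  desubstitute : ∀ n → Overlap v ⊎ (∃[ k ] Differ v k (2 ℕ.^ n) (2 ℕ.^ n ℕ.* 2))
  desubstitute zero with square-or-overlap (halve v c)
  ... | inj₂ o = inj₁ (overlap-double o)
  ... | inj₁ (s , sq′) with blocks-or-overlap v r sq (2 ℕ.+ s)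
  ...   | inj₂ o = inj₁ o
  -- Equal neighbours in `halve v c` are two equal blocks in `v`; their first three letters are a
  -- letter, its complement and the letter again.
  ...   | inj₁ b = inj₂ (suc s ℕ.* 2 ℕ.+ c ,
            b (suc s) ℕ.≤-refl
         ∷ᶜ (λ e → b (suc s) ℕ.≤-refl (trans sq′ (sym e)))
         ∷ᶜ correlated-[])
  desubstitute (suc n) with overlap-or-differ n (halve v c)
  ... | inj₁ o = inj₁ (overlap-double o)
  ... | inj₂ (k , rs) with blocks-or-overlap v r sq (2 ℕ.^ n ℕ.* 2 ℕ.+ (2 ℕ.^ n ℕ.+ k))
  ...   | inj₂ o = inj₁ o
  ...   | inj₁ b = inj₂ (k ℕ.* 2 ℕ.+ c ,
            subst (λ m → Differ v (k ℕ.* 2 ℕ.+ c) m (m ℕ.* 2)) (ℕ.*-comm (2 ℕ.^ n) 2)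
              (correlated-double v c ≢-flip b rs))

-- Factors of fixed points of morphisms

OccursAt : ∀ {k} → ωWord k → ℕ → Word k → Set
OccursAt w n []      = ⊤
OccursAt w n (c ∷ u) = w n ≡ c × OccursAt w (suc n) u

Occurs : ∀ {k} → ωWord k → Word k → Set
Occurs w u = ∃[ n ] OccursAt w n u

slice : ∀ {k} → ωWord k → ℕ → ℕ → Word k
slice w n zero    = []
slice w n (suc l) = w n ∷ slice w (suc n) l

module _ {k} (w : ωWord k) where

  occursAt-++⁻ˡ : ∀ n u {v} → OccursAt w n (u ++ v) → OccursAt w n u
  occursAt-++⁻ˡ n []      o       = tt
  occursAt-++⁻ˡ n (c ∷ u) (e , o) = e , occursAt-++⁻ˡ (suc n) u o

  occursAt-++⁻ʳ : ∀ n u {v} → OccursAt w n (u ++ v) → OccursAt w (length u ℕ.+ n) v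
  occursAt-++⁻ʳ n []      o       = o
  occursAt-++⁻ʳ n (c ∷ u) {v} (e , o) = subst (λ m → OccursAt w m v)
    (ℕ.+-suc (length u) n) (occursAt-++⁻ʳ (suc n) u o)

  occursAt-++⁺ : ∀ n u {v} → OccursAt w n u → OccursAt w (length u ℕ.+ n) v →
                 OccursAt w n (u ++ v)
  occursAt-++⁺ n []      o o′ = o′
  occursAt-++⁺ n (c ∷ u) {v} (e , o) o′ = e , occursAt-++⁺ (suc n) u o
    (subst (λ m → OccursAt w m v) (sym (ℕ.+-suc (length u) n)) o′)

  occurs-infix : ∀ {x} u {y} → Occurs w (x ++ u ++ y) → Occurs w u
  occurs-infix {x} u (n , o) = length x ℕ.+ n , occursAt-++⁻ˡ _ u (occursAt-++⁻ʳ n x o)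

  occursAt-slice : ∀ n l → OccursAt w n (slice w n l)
  occursAt-slice n zero    = tt
  occursAt-slice n (suc l) = refl , occursAt-slice (suc n) l

  occursAt-≡slice : ∀ n u → OccursAt w n u → u ≡ slice w n (length u)
  occursAt-≡slice n []      o          = refl
  occursAt-≡slice n (c ∷ u) (refl , o) = cong (c ∷_) (occursAt-≡slice (suc n) u o)

  length-slice : ∀ n l → length (slice w n l) ≡ l
  length-slice n zero    = refl
  length-slice n (suc l) = cong suc (length-slice (suc n) l)

applyUpTo-slice : ∀ {k} (w : ωWord k) n l f → (∀ i → f i ≡ w (i ℕ.+ n)) →
                  applyUpTo f l ≡ slice w n l
applyUpTo-slice w n zero    f e = refl
applyUpTo-slice w n (suc l) f e = cong₂ _∷_ (e 0)
  (applyUpTo-slice w (suc n) l (f ∘ suc) λ i → trans (e (suc i)) (cong w (sym (ℕ.+-suc i n))))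

take-length-++ : ∀ {k} (u v : Word k) → take (length u) (u ++ v) ≡ u
take-length-++ []      v = refl
take-length-++ (c ∷ u) v = cong (c ∷_) (take-length-++ u v)

module _ {k} (φ : Morphism k) where

  power-++ : ∀ n u v → power φ n (u ++ v) ≡ power φ n u ++ power φ n v
  power-++ zero    u v = refl
  power-++ (suc n) u v = trans (cong (power φ n) (List.concatMap-++ φ u v))
    (power-++ n (concatMap φ u) (concatMap φ v))

  power-suc : ∀ n u → power φ (suc n) u ≡ concatMap φ (power φ n u)
  power-suc zero    u = refl
  power-suc (suc n) u = power-suc n (concatMap φ u)

  power-1+ : ∀ n c → power φ (suc n) [ c ] ≡ power φ n (φ c)
  power-1+ n c = cong (power φ n) (List.++-identityʳ (φ c))

  power≡[]⇒mortal : ∀ {j} → 1 ℕ.≤ j → ∀ u → power φ j u ≡ [] → All (Mortal φ) u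
  power≡[]⇒mortal 1≤j [] e = []
  power≡[]⇒mortal {j} 1≤j (c ∷ u) e = (j , 1≤j , List.++-conicalˡ _ _ e′)
      ∷ power≡[]⇒mortal 1≤j u (List.++-conicalʳ (power φ j [ c ]) _ e′)
    where
    e′ : power φ j [ c ] ++ power φ j u ≡ []
    e′ = trans (sym (power-++ j [ c ] u)) e

  Growing : Fin k → Set
  Growing c = ∀ K → ∃[ n ] K ℕ.≤ length (power φ n [ c ])

  length-power-∷ : ∀ n c u → length (power φ n (c ∷ u)) ≡
                   length (power φ n [ c ]) ℕ.+ length (power φ n u)
  length-power-∷ n c u = trans (cong length (power-++ n [ c ] u)) (List.length-++ (power φ n [ c ]))

  module _ {a} {y} (φa≡ : φ a ≡ a ∷ y) (y≁ε : ¬ All (Mortal φ) y) where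

    power-prolong : ∀ n → power φ (suc n) [ a ] ≡ power φ n [ a ] ++ power φ n y
    power-prolong n = trans (power-1+ n a) (trans (cong (power φ n) φa≡) (power-++ n [ a ] y))

    power-tail≢[] : ∀ n → power φ n y ≢ []
    power-tail≢[] zero    refl = y≁ε []
    power-tail≢[] (suc n) e    = y≁ε (power≡[]⇒mortal {suc n} (s≤s z≤n) y e)

    -- φⁿ⁺¹(a) = φⁿ(a) φⁿ(y), and the second factor is never empty because `y` does not consist of
    -- mortal letters.
    n≤∣φⁿa∣ : ∀ n → n ℕ.≤ length (power φ n [ a ])
    n≤∣φⁿa∣ zero = z≤n
    n≤∣φⁿa∣ (suc n) rewrite power-prolong n | List.length-++ (power φ n [ a ]) {power φ n y}
      with power φ n y | power-tail≢[] n
    ... | []    | ne = ⊥-elim (ne refl)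
    ... | _ ∷ z | _  = subst (ℕ._≤ length (power φ n [ a ]) ℕ.+ suc (length z))
                         (ℕ.+-comm n 1) (ℕ.+-mono-≤ (n≤∣φⁿa∣ n) (s≤s z≤n))

    prolongable-growing : Growing a
    prolongable-growing K = K , n≤∣φⁿa∣ K

    power-prefix : ∀ m n → ∃[ z ] power φ (m ℕ.+ n) [ a ] ≡ power φ n [ a ] ++ z
    power-prefix zero    n = [] , sym (List.++-identityʳ _)
    power-prefix (suc m) n with power-prefix m n
    ... | z , e = z ++ power φ (m ℕ.+ n) y , trans (power-prolong (m ℕ.+ n))
      (trans (cong (_++ power φ (m ℕ.+ n) y) e) (List.++-assoc (power φ n [ a ]) z _))

    module _ {w} (lim : (λ n → power φ n [ a ]) ⟶ʷ w) where

      -- The term with index `N + n` begins with φⁿ(a) and, by convergence, also with the prefix of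
      -- `w` of that length.
      power-occurs : ∀ n → OccursAt w 0 (power φ n [ a ])
      power-occurs n with lim (length (power φ n [ a ]))
      ... | N , h = subst (OccursAt w 0)
          (sym (trans (sym (trans (cong (take l) (proj₂ pre)) (take-length-++ _ _)))
                 (trans (h (N ℕ.+ n) (ℕ.m≤m+n N n))
                        (applyUpTo-slice w 0 l w λ i → cong w (sym (ℕ.+-identityʳ i))))))
          (occursAt-slice w 0 l)
        where
        l = length (power φ n [ a ])
        pre = power-prefix N n

      prefix-of-power : ∀ u → OccursAt w 0 u → ∃₂ λ n y → power φ n [ a ] ≡ u ++ y
      prefix-of-power u o with lim (length u)
      ... | N , h = N , drop (length u) (power φ N [ a ]) , (begin
          power φ N [ a ]
            ≡⟨ List.take++drop≡id (length u) _ ⟨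
          take (length u) (power φ N [ a ]) ++ d
            ≡⟨ cong (_++ d) (h N ℕ.≤-refl) ⟩
          applyUpTo w (length u) ++ d
            ≡⟨ cong (_++ d) (applyUpTo-slice w 0 (length u) w λ i → cong w (sym (ℕ.+-identityʳ i))) ⟩
          slice w 0 (length u) ++ d
            ≡⟨ cong (_++ d) (occursAt-≡slice w 0 u o) ⟨
          u ++ d ∎)
        where
        open ≡-Reasoning
        d = drop (length u) (power φ N [ a ])

      -- Takes the place of φ(w) = w: a factor of `w` lies in some φᴺ(a), so its image lies in
      -- φᴺ⁺¹(a), which is a prefix of `w`.
      occurs-φ : ∀ {u} → Occurs w u → Occurs w (concatMap φ u)
      occurs-φ {u} (n , o)
        with prefix-of-power (slice w 0 n ++ u) (occursAt-++⁺ w 0 (slice w 0 n) (occursAt-slice w 0 n)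
               (subst (λ m → OccursAt w m u)
                 (sym (trans (ℕ.+-identityʳ _) (length-slice w 0 n))) o))
      ... | N , z , e = occurs-infix w {concatMap φ (slice w 0 n)} (concatMap φ u)
          (0 , subst (OccursAt w 0) eq (power-occurs (suc N)))
        where
        open ≡-Reasoning
        eq : power φ (suc N) [ a ] ≡
             concatMap φ (slice w 0 n) ++ concatMap φ u ++ concatMap φ z
        eq = begin
          power φ (suc N) [ a ]                     ≡⟨ power-suc N [ a ] ⟩
          concatMap φ (power φ N [ a ])             ≡⟨ cong (concatMap φ) e ⟩
          concatMap φ ((slice w 0 n ++ u) ++ z)
            ≡⟨ cong (concatMap φ) (List.++-assoc (slice w 0 n) u z) ⟩
          concatMap φ (slice w 0 n ++ (u ++ z))     ≡⟨ List.concatMap-++ φ (slice w 0 n) (u ++ z) ⟩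
          concatMap φ (slice w 0 n) ++ concatMap φ (u ++ z)
            ≡⟨ cong (concatMap φ (slice w 0 n) ++_) (List.concatMap-++ φ u z) ⟩
          concatMap φ (slice w 0 n) ++ concatMap φ u ++ concatMap φ z ∎

      occurs-power : ∀ n {u} → Occurs w u → Occurs w (power φ n u)
      occurs-power zero    o = o
      occurs-power (suc n) o = occurs-power n (occurs-φ o)

-- Repetitions in binary pure morphic words.

occursAt-≗ : ∀ {k} (w : ωWord k) m n L → (∀ i → i ℕ.< L → w (i ℕ.+ m) ≡ w (i ℕ.+ n)) →
             OccursAt w m (slice w n L)
occursAt-≗ w m n zero    e = tt
occursAt-≗ w m n (suc L) e = e 0 (s≤s z≤n) , occursAt-≗ w (suc m) (suc n) L λ i i<L →
  trans (cong w (ℕ.+-suc i m)) (trans (e (suc i) (s≤s i<L)) (cong w (sym (ℕ.+-suc i n))))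

occursAt-avoid : ∀ {k} (w : ωWord k) {a} n r → OccursAt w n r → All (_≢ a) r →
                 ∀ i → i ℕ.< length r → w (i ℕ.+ n) ≢ a
occursAt-avoid w n (c ∷ r) (refl , o) (c≢a ∷ _) zero _ = c≢a
occursAt-avoid w {a} n (c ∷ r) (_ , o) (_ ∷ r≢a) (suc i) (s≤s i<) =
  subst (λ m → w m ≢ a) (ℕ.+-suc i n) (occursAt-avoid w (suc n) r o r≢a i i<)

private
  module ++-Solver = Algebra.Solver.Monoid (List.++-monoid (Fin 2))

module _ (w : ωWord 2) where

  occursAt-agree : ∀ n p u → OccursAt w n u → OccursAt w (p ℕ.+ n) u → Agree w n p (length u)
  occursAt-agree n p []      _       _         = correlated-[]
  occursAt-agree n p (c ∷ u) (e , o) (e′ , o′) = trans e (sym e′)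
    ∷ᶜ occursAt-agree (suc n) p u o (subst (λ m → OccursAt w m u) (sym (ℕ.+-suc p n)) o′)

  -- The word `xyxyx` has `xyx` both as a prefix and, after `xy`, as a suffix.
  occurs-period : ∀ x y → Occurs w ((x ++ y) ++ (x ++ y) ++ x) →
    ∃[ n ] Agree w n (length (x ++ y)) (length ((x ++ y) ++ x))
  occurs-period x y (n , o) = n , occursAt-agree n (length (x ++ y)) ((x ++ y) ++ x)
      (occursAt-++⁻ˡ w n ((x ++ y) ++ x) (subst (OccursAt w n) eq o))
      (occursAt-++⁻ʳ w n (x ++ y) o)
    where
    open ++-Solver
    eq : (x ++ y) ++ (x ++ y) ++ x ≡ ((x ++ y) ++ x) ++ (y ++ x)
    eq = solve 2 (λ x y → (x ⊕ y) ⊕ (x ⊕ y) ⊕ x ⊜ ((x ⊕ y) ⊕ x) ⊕ (y ⊕ x)) refl x y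

  overlap-occurs : Overlap w → ∃₂ λ c u → Occurs w ((c ∷ u) ++ (c ∷ u) ++ [ c ])
  overlap-occurs (k , p , rs) = w k , slice w (suc k) p , k ,
      occursAt-++⁺ w k s (occursAt-slice w k (suc p))
        (subst (λ l → OccursAt w (l ℕ.+ k) (s ++ [ w k ])) (sym (length-slice w k (suc p)))
          (occursAt-++⁺ w (suc p ℕ.+ k) s
            (occursAt-≗ w (suc p ℕ.+ k) k (suc p) λ i i< → sym (rs .at i (ℕ.m≤n⇒m≤1+n i<)))
            (subst (λ l → w (l ℕ.+ (suc p ℕ.+ k)) ≡ w k) (sym (length-slice w k (suc p)))
              -- The last letter is reached from the first in two periods; the second one uses the
              -- last comparison that `Overlap` provides.
              (sym (trans (rs .at 0 (s≤s z≤n)) (rs .at (suc p) ℕ.≤-refl))) , tt)))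
    where
    s = slice w k (suc p)

-- Of the `p + K` comparisons, `p` pay for q |q|₂, which is about 2 ^ p, and `K` are the gain. The
-- condition `1 ≤ p` keeps 2 ^ p - 1 positive.
Repetitive : ωWord 2 → Set
Repetitive w = ∀ K → ∃₂ λ k p → 1 ℕ.≤ p × (Agree w k p (p ℕ.+ K) ⊎ Differ w k p (p ℕ.+ K))

module _ {k} (a : Fin k) where

  first-split : ∀ u → All (_≢ a) u ⊎ ∃₂ λ r s → u ≡ r ++ a ∷ s × All (_≢ a) r
  first-split [] = inj₁ []
  first-split (c ∷ u) with c ≟ a
  ... | yes refl = inj₂ ([] , u , refl , [])
  ... | no c≢a with first-split u
  ...   | inj₁ u≢a = inj₁ (c≢a ∷ u≢a)
  ...   | inj₂ (r , s , refl , r≢a) = inj₂ (c ∷ r , s , refl , c≢a ∷ r≢a)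

  last-split : ∀ u → All (_≢ a) u ⊎ ∃₂ λ t s → u ≡ t ++ a ∷ s × All (_≢ a) s
  last-split [] = inj₁ []
  last-split (c ∷ u) with last-split u
  ... | inj₂ (t , s , refl , s≢a) = inj₂ (c ∷ t , s , refl , s≢a)
  ... | inj₁ u≢a with c ≟ a
  ...   | yes refl = inj₂ ([] , u , refl , u≢a)
  ...   | no c≢a   = inj₁ (c≢a ∷ u≢a)

module _ {φ : Morphism 2} {a : Fin 2} {y : Word 2} (φa≡ : φ a ≡ a ∷ y) (y≁ε : ¬ All (Mortal φ) y)
         {w : ωWord 2} (lim : (λ n → power φ n [ a ]) ⟶ʷ w) where

  private
    occurs-apply : ∀ {u} → Occurs w u → Occurs w (concatMap φ u)
    occurs-apply = occurs-φ φ φa≡ y≁ε lim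

    occurs-a : Occurs w [ a ]
    occurs-a = 0 , power-occurs φ φa≡ y≁ε lim 0

    occurs-first-return : ∀ {r s} → φ a ≡ a ∷ r ++ a ∷ s → Occurs w ([ a ] ++ r ++ [ a ])
    occurs-first-return {r} {s} φa≡′ =
      occurs-infix w {[]} ([ a ] ++ r ++ [ a ]) {s} (subst (Occurs w) (begin
        φ a ++ []                      ≡⟨ List.++-identityʳ _ ⟩
        φ a                            ≡⟨ φa≡′ ⟩
        [ a ] ++ r ++ [ a ] ++ s
          ≡⟨ solve 3 (λ a r s → a ⊕ r ⊕ a ⊕ s ⊜ (a ⊕ r ⊕ a) ⊕ s) refl [ a ] r s ⟩
        ([ a ] ++ r ++ [ a ]) ++ s     ∎) (occurs-apply occurs-a))
      where
      open ++-Solver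
      open ≡-Reasoning

  -- With C = φᵐ(c) and V = φᵐ(u), the image CVCVC has period |CV| over |CV| + |C| comparisons.
  -- Choosing |C| > `K` also makes the period positive.
  overlap-repetitive : ∀ c u → Growing φ c → Occurs w ((c ∷ u) ++ (c ∷ u) ++ [ c ]) → Repetitive w
  overlap-repetitive c u grow o K with grow (suc K)
  ... | m , K<∣C∣ with occurs-period w C V (subst (Occurs w) eq (occurs-power φ φa≡ y≁ε lim m o))
    where
    C = power φ m [ c ]
    V = power φ m u
    eq : power φ m ((c ∷ u) ++ (c ∷ u) ++ [ c ]) ≡ (C ++ V) ++ (C ++ V) ++ C
    eq = trans (power-++ φ m (c ∷ u) _) (cong₂ _++_ (power-++ φ m [ c ] u)
           (trans (power-++ φ m (c ∷ u) [ c ]) (cong (_++ C) (power-++ φ m [ c ] u))))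
  ... | n , agree = n , _ ,
    ℕ.≤-trans (ℕ.≤-trans (s≤s z≤n) K<∣C∣) (List.length-++-≤ˡ (power φ m [ c ])) ,
    inj₁ (correlated-≤
      (ℕ.≤-trans (ℕ.+-monoʳ-≤ (length U) (ℕ.<⇒≤ K<∣C∣))
                 (ℕ.≤-reflexive (sym (List.length-++ U))))
      agree)
    where
    U = power φ m [ c ] ++ power φ m u

  Inert : Fin 2 → Set
  Inert c = c ≢ a × (φ c ≡ [] ⊎ φ c ≡ [ c ])

  private
    growing-by-a : ∀ {c x z} → φ c ≡ x ++ a ∷ z → Growing φ c
    growing-by-a {c} {x} {z} eq K with prolongable-growing φ φa≡ y≁ε K
    ... | n , K≤ = suc n , ℕ.≤-trans K≤ (subst (length (power φ n [ a ]) ℕ.≤_)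
        (cong length (sym eq′))
        (ℕ.≤-trans (List.length-++-≤ˡ (power φ n [ a ]))
                   (List.length-++-≤ʳ (power φ n [ a ] ++ power φ n z) {power φ n x})))
      where
      eq′ : power φ (suc n) [ c ] ≡ power φ n x ++ power φ n [ a ] ++ power φ n z
      eq′ = trans (power-1+ φ n c) (trans (cong (power φ n) eq)
              (trans (power-++ φ n x (a ∷ z)) (cong (power φ n x ++_) (power-++ φ n [ a ] z))))

    growing-by-doubling : ∀ {c z} → φ c ≡ c ∷ c ∷ z → Growing φ c
    growing-by-doubling {c} {z} eq K = K , ℕ.<⇒≤ (n<∣φⁿc∣ K)
      where
      n<∣φⁿc∣ : ∀ n → n ℕ.< length (power φ n [ c ])
      n<∣φⁿc∣ zero = s≤s z≤n
      n<∣φⁿc∣ (suc n) = subst (suc n ℕ.<_)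
          (sym (trans (cong length (trans (power-1+ φ n c) (cong (power φ n) eq)))
                 (trans (length-power-∷ φ n c (c ∷ z))
                        (cong (length (power φ n [ c ]) ℕ.+_) (length-power-∷ φ n c z)))))
          (ℕ.+-mono-≤ (ℕ.≤-trans (s≤s z≤n) (n<∣φⁿc∣ n))
                      (ℕ.≤-trans (n<∣φⁿc∣ n) (ℕ.m≤m+n _ _)))

  -- For c ≠ a the first two letters of φ(c) decide: an `a` there puts φⁿ(a) inside φⁿ⁺¹(c), and
  -- `c c` at least doubles the length at each step.
  growing-or-inert : ∀ c → Growing φ c ⊎ Inert c
  growing-or-inert c with c ≟ a
  ... | yes refl = inj₁ (prolongable-growing φ φa≡ y≁ε)
  ... | no c≢a with φ c in eq
  ...   | [] = inj₂ (c≢a , inj₁ refl)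
  ...   | d ∷ u with d ≟ a
  ...     | yes refl = inj₁ (growing-by-a {x = []} eq)
  ...     | no d≢a with ≢≢⇒≡ c≢a (d≢a ∘ sym) | u
  ...       | refl | [] = inj₂ (c≢a , inj₂ refl)
  ...       | refl | e ∷ z with e ≟ a
  ...         | yes refl = inj₁ (growing-by-a {x = [ d ]} eq)
  ...         | no e≢a with ≢≢⇒≡ c≢a (e≢a ∘ sym)
  ...           | refl = inj₁ (growing-by-doubling eq)

  -- Write φ(a) = a r a s₀ = t a s with `r` and `s` free of `a`. As φ erases `r`, φ(a r a) = φ(a)
  -- φ(a), and its seam contains a s a r a. As φ erases `s` too, the image of that word is the cube
  -- of φ(a) = a y.
  erasing-repetitive : (∀ c → c ≢ a → φ c ≡ []) → Repetitive w
  erasing-repetitive φ-erases with first-split a y | last-split a (φ a)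
  -- Without an `a`, all letters of `y` would be erased in one step, hence mortal.
  ... | inj₁ y≢a | _ = ⊥-elim (y≁ε (All.map (λ {c} c≢a → 1 , s≤s z≤n ,
          trans (List.++-identityʳ (φ c)) (φ-erases c c≢a)) y≢a))
  ... | inj₂ _ | inj₁ φa≢a with subst (All (_≢ a)) φa≡ φa≢a
  ...   | a≢a ∷ _ = ⊥-elim (a≢a refl)
  erasing-repetitive φ-erases | inj₂ (r , s₀ , y≡ , r≢a) | inj₂ (t , s , φa≡′ , s≢a) =
    overlap-repetitive a y (prolongable-growing φ φa≡ y≁ε) occurs-ayaya
    where
    open ++-Solver
    open ≡-Reasoning

    erase : ∀ {u} → All (_≢ a) u → concatMap φ u ≡ []
    erase []          = refl
    erase {c ∷ u} (c≢a ∷ u≢a) rewrite φ-erases c c≢a = erase u≢a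

    A = [ a ]

    φa-first : φ a ≡ A ++ r ++ A ++ s₀
    φa-first = trans φa≡ (cong (a ∷_) y≡)

    occurs-ara : Occurs w (A ++ r ++ A)
    occurs-ara = occurs-first-return φa-first

    φ-ara : concatMap φ (A ++ r ++ A) ≡ φ a ++ φ a
    φ-ara = cong (φ a ++_) (trans (List.concatMap-++ φ r A)
              (cong₂ _++_ (erase r≢a) (List.++-identityʳ (φ a))))

    occurs-asara : Occurs w (A ++ s ++ A ++ r ++ A)
    occurs-asara = occurs-infix w {t} (A ++ s ++ A ++ r ++ A) {s₀} (subst (Occurs w) (begin
      concatMap φ (A ++ r ++ A)              ≡⟨ φ-ara ⟩
      φ a ++ φ a                             ≡⟨ cong₂ _++_ φa≡′ φa-first ⟩
      (t ++ A ++ s) ++ (A ++ r ++ A ++ s₀)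
        ≡⟨ solve 5 (λ t a s r s₀ → (t ⊕ a ⊕ s) ⊕ (a ⊕ r ⊕ a ⊕ s₀) ⊜ t ⊕ (a ⊕ s ⊕ a ⊕ r ⊕ a) ⊕ s₀)
             refl t A s r s₀ ⟩
      t ++ (A ++ s ++ A ++ r ++ A) ++ s₀ ∎) (occurs-apply occurs-ara))

    occurs-ayaya : Occurs w ((a ∷ y) ++ (a ∷ y) ++ [ a ])
    occurs-ayaya = occurs-infix w {[]} ((a ∷ y) ++ (a ∷ y) ++ [ a ]) {y} (subst (Occurs w) (begin
      concatMap φ (A ++ s ++ A ++ r ++ A)
        ≡⟨ cong (φ a ++_) (List.concatMap-++ φ s (A ++ r ++ A)) ⟩
      φ a ++ concatMap φ s ++ concatMap φ (A ++ r ++ A)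
        ≡⟨ cong (φ a ++_) (cong₂ _++_ (erase s≢a) φ-ara) ⟩
      φ a ++ φ a ++ φ a
        ≡⟨ cong (λ u → u ++ u ++ u) φa≡ ⟩
      (A ++ y) ++ (A ++ y) ++ (A ++ y)
        ≡⟨ solve 2 (λ a y → (a ⊕ y) ⊕ (a ⊕ y) ⊕ (a ⊕ y) ⊜ ((a ⊕ y) ⊕ (a ⊕ y) ⊕ a) ⊕ y) refl A y ⟩
      ((A ++ y) ++ (A ++ y) ++ A) ++ y ∎) (occurs-apply occurs-asara))

  module _ (φ-fixes : ∀ c → c ≢ a → φ c ≡ [ c ]) where

    private
      fix : ∀ {u} → All (_≢ a) u → concatMap φ u ≡ u
      fix [] = refl
      fix {c ∷ u} (c≢a ∷ u≢a) rewrite φ-fixes c c≢a = cong (c ∷_) (fix u≢a)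

      power-fix : ∀ n {u} → All (_≢ a) u → power φ n u ≡ u
      power-fix zero    u≢a = refl
      power-fix (suc n) u≢a = trans (cong (power φ n) (fix u≢a)) (power-fix n u≢a)

    -- φⁿ⁺¹(a) = φⁿ(t) φⁿ(a) b s, since φ fixes the letters of `b s`. So the `a`-free end of φⁿ(a),
    -- a power of the other letter, grows with n.
    run-repetitive : ∀ t b s → φ a ≡ t ++ a ∷ b ∷ s → All (_≢ a) (b ∷ s) → Repetitive w
    -- The `1 + K` comparisons at distance 1 involve `2 + K` letters.
    run-repetitive t b s φa≡t bs≢a K with suffix (2 ℕ.+ K)
      where
      suffix : ∀ n → ∃₂ λ x r → power φ n [ a ] ≡ x ++ r × All (_≢ a) r × n ℕ.≤ length r
      suffix zero = [ a ] , [] , refl , [] , z≤n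
      suffix (suc n) with suffix n
      ... | x , r , e , r≢a , n≤ = power φ n t ++ x , r ++ b ∷ s , (begin
            power φ (suc n) [ a ]                   ≡⟨ power-1+ φ n a ⟩
            power φ n (φ a)                         ≡⟨ cong (power φ n) φa≡t ⟩
            power φ n (t ++ [ a ] ++ b ∷ s)         ≡⟨ power-++ φ n t _ ⟩
            power φ n t ++ power φ n ([ a ] ++ b ∷ s)
              ≡⟨ cong (power φ n t ++_) (power-++ φ n [ a ] (b ∷ s)) ⟩
            power φ n t ++ power φ n [ a ] ++ power φ n (b ∷ s)
              ≡⟨ cong (power φ n t ++_) (cong₂ _++_ e (power-fix n bs≢a)) ⟩
            power φ n t ++ (x ++ r) ++ b ∷ s
              ≡⟨ ++-Solver.solve 4 (λ t x r s → t ⊕ (x ⊕ r) ⊕ s ⊜ (t ⊕ x) ⊕ (r ⊕ s)) refl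
                   (power φ n t) x r (b ∷ s) ⟩
            (power φ n t ++ x) ++ (r ++ b ∷ s) ∎) ,
            All.++⁺ r≢a bs≢a ,
            subst (suc n ℕ.≤_) (trans (sym (ℕ.+-suc _ _)) (sym (List.length-++ r)))
              (s≤s (ℕ.≤-trans n≤ (ℕ.m≤m+n _ _)))
        where
        open ≡-Reasoning
        open ++-Solver using (_⊕_; _⊜_)
    ... | x , r , e , r≢a , l = length x ℕ.+ 0 , 1 , s≤s z≤n , inj₁ agree
      where
      avoid : ∀ i → i ℕ.< length r → w (i ℕ.+ (length x ℕ.+ 0)) ≢ a
      avoid = occursAt-avoid w (length x ℕ.+ 0) r (occursAt-++⁻ʳ w 0 x
        (subst (OccursAt w 0) e (power-occurs φ φa≡ y≁ε lim (2 ℕ.+ K)))) r≢a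
      agree : Agree w (length x ℕ.+ 0) 1 (1 ℕ.+ K)
      agree .at i i< = ≢≢⇒≡ (avoid i (ℕ.≤-trans i< (ℕ.<⇒≤ l)))
        (subst (λ m → w m ≢ a) (sym (ℕ.+-suc i _)) (avoid (suc i) (ℕ.≤-trans (s≤s i<) l)) ∘ sym)

    -- As φ fixes `r`, φ(a r a) = φ(a) r φ(a). Here the last `a` of the first φ(a), the middle `r`
    -- and the prefix a r a of the second φ(a) join to a r a r a.
    return-repetitive : ∀ r s₀ t → φ a ≡ a ∷ r ++ a ∷ s₀ → φ a ≡ t ++ [ a ] → All (_≢ a) r →
                        Repetitive w
    return-repetitive r s₀ t φa-first φa-last r≢a =
      overlap-repetitive a r (prolongable-growing φ φa≡ y≁ε) occurs-arara
      where
      open ++-Solver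
      open ≡-Reasoning

      A = [ a ]

      occurs-arara : Occurs w ((a ∷ r) ++ (a ∷ r) ++ A)
      occurs-arara = occurs-infix w {t} ((a ∷ r) ++ (a ∷ r) ++ A) {s₀} (subst (Occurs w) (begin
        concatMap φ (A ++ r ++ A)
          ≡⟨ cong (φ a ++_) (trans (List.concatMap-++ φ r A)
               (cong₂ _++_ (fix r≢a) (List.++-identityʳ (φ a)))) ⟩
        φ a ++ r ++ φ a
          ≡⟨ cong₂ (λ u v → u ++ r ++ v) φa-last φa-first ⟩
        (t ++ A) ++ r ++ (A ++ r ++ A ++ s₀)
          ≡⟨ solve 4 (λ t a r s₀ → (t ⊕ a) ⊕ r ⊕ (a ⊕ r ⊕ a ⊕ s₀) ⊜ t ⊕ ((a ⊕ r) ⊕ (a ⊕ r) ⊕ a) ⊕ s₀)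
               refl t A r s₀ ⟩
        t ++ ((A ++ r) ++ (A ++ r) ++ A) ++ s₀ ∎) (occurs-apply (occurs-first-return φa-first)))

    -- The last letter of φ(a) decides: the fixed letter accumulates in runs, while `a` creates an
    -- overlap with the first return to `a`.
    fixing-repetitive : Repetitive w
    fixing-repetitive with first-split a y
    ... | inj₁ [] = ⊥-elim (y≁ε [])
    ... | inj₁ (b≢a ∷ s≢a) = run-repetitive [] _ _ φa≡ (b≢a ∷ s≢a)
    ... | inj₂ (r , s₀ , y≡ , r≢a) with last-split a (φ a)
    ...   | inj₁ φa≢a with subst (All (_≢ a)) φa≡ φa≢a
    ...     | a≢a ∷ _ = ⊥-elim (a≢a refl)
    fixing-repetitive | inj₂ (r , s₀ , y≡ , r≢a) | inj₂ (t , [] , φa≡′ , []) =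
      return-repetitive r s₀ t (trans φa≡ (cong (a ∷_) y≡)) φa≡′ r≢a
    fixing-repetitive | inj₂ _ | inj₂ (t , b ∷ s , φa≡′ , s≢a) =
      run-repetitive t b s φa≡′ s≢a

  inert-repetitive : ∀ b → Inert b → Repetitive w
  inert-repetitive b (b≢a , inj₁ φb≡[]) = erasing-repetitive λ c c≢a →
    subst (λ d → φ d ≡ []) (≢≢⇒≡ b≢a (c≢a ∘ sym)) φb≡[]
  inert-repetitive b (b≢a , inj₂ φb≡[b]) = fixing-repetitive λ c c≢a →
    subst (λ d → φ d ≡ [ d ]) (≢≢⇒≡ b≢a (c≢a ∘ sym)) φb≡[b]

n<2^n : ∀ n → n ℕ.< 2 ℕ.^ n
n<2^n zero = s≤s z≤n
n<2^n (suc n) = ℕ.+-mono-≤ (ℕ.≤-trans (s≤s z≤n) (n<2^n n)) (ℕ.≤-trans (n<2^n n) (ℕ.m≤m+n _ 0))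

pureMorphic-repetitive : ∀ {w : ωWord 2} → PureMorphic w → Repetitive w
pureMorphic-repetitive {w} (φ , a , (y , φa≡ , y≁ε) , lim) K with overlap-or-differ K w
... | inj₂ (k , rs) = k , 2 ℕ.^ K , ℕ.m^n>0 2 K , inj₂ (correlated-≤
        (subst (2 ℕ.^ K ℕ.+ K ℕ.≤_) (ℕ.*-comm 2 (2 ℕ.^ K))
          (ℕ.+-monoʳ-≤ (2 ℕ.^ K) (ℕ.≤-trans (ℕ.<⇒≤ (n<2^n K)) (ℕ.m≤m+n _ 0)))) rs)
... | inj₁ o with overlap-occurs w o
...   | c , u , occ with growing-or-inert φa≡ y≁ε lim c
...     | inj₁ grow  = overlap-repetitive φa≡ y≁ε lim c u grow occ K
...     | inj₂ inert = inert-repetitive φa≡ y≁ε lim c inert K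

-- Rational estimates

open ℚSolver.+-*-Solver

toℚᵘ-/1 : ∀ i → ℚ.toℚᵘ (i ℚ./ 1) ℚᵘ.≃ ℚᵘ.mkℚᵘ i 0
toℚᵘ-/1 i = ℚ.toℚᵘ-fromℚᵘ (ℚᵘ.mkℚᵘ i 0)

/1-+ : ∀ i j → (i ℤ.+ j) ℚ./ 1 ≡ (i ℚ./ 1) ℚ.+ (j ℚ./ 1)
/1-+ i j = ℚ.toℚᵘ-injective (ℚᵘ.≃-trans (toℚᵘ-/1 (i ℤ.+ j)) (ℚᵘ.≃-sym
  (ℚᵘ.≃-trans (ℚ.toℚᵘ-homo-+ (i ℚ./ 1) (j ℚ./ 1))
    (ℚᵘ.≃-trans (ℚᵘ.+-cong (toℚᵘ-/1 i) (toℚᵘ-/1 j))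
      (ℚᵘ.*≡* (cong (ℤ._* + 1) (cong₂ ℤ._+_ (ℤ.*-identityʳ i) (ℤ.*-identityʳ j))))))))

/1-* : ∀ i j → (i ℤ.* j) ℚ./ 1 ≡ (i ℚ./ 1) ℚ.* (j ℚ./ 1)
/1-* i j = ℚ.toℚᵘ-injective (ℚᵘ.≃-trans (toℚᵘ-/1 (i ℤ.* j)) (ℚᵘ.≃-sym
  (ℚᵘ.≃-trans (ℚ.toℚᵘ-homo-* (i ℚ./ 1) (j ℚ./ 1))
    (ℚᵘ.≃-trans (ℚᵘ.*-cong (toℚᵘ-/1 i) (toℚᵘ-/1 j)) (ℚᵘ.*≡* refl)))))

/1-neg : ∀ i → (ℤ.- i) ℚ./ 1 ≡ ℚ.- (i ℚ./ 1)
/1-neg i = ℚ.toℚᵘ-injective (ℚᵘ.≃-trans (toℚᵘ-/1 (ℤ.- i)) (ℚᵘ.≃-sym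
  (ℚᵘ.≃-trans (ℚ.toℚᵘ-homo‿- (i ℚ./ 1)) (ℚᵘ.-‿cong (toℚᵘ-/1 i)))))

ℕ→ℚ-+ : ∀ m n → ℕ→ℚ (m ℕ.+ n) ≡ ℕ→ℚ m ℚ.+ ℕ→ℚ n
ℕ→ℚ-+ m n = /1-+ (+ m) (+ n)

ℕ→ℚ-* : ∀ m n → ℕ→ℚ (m ℕ.* n) ≡ ℕ→ℚ m ℚ.* ℕ→ℚ n
ℕ→ℚ-* m n = trans (cong (ℚ._/ 1) (ℤ.pos-* m n)) (/1-* (+ m) (+ n))

ℕ→ℚ-mono : ∀ {m n} → m ℕ.≤ n → ℕ→ℚ m ℚ.≤ ℕ→ℚ n
ℕ→ℚ-mono {m} {n} m≤n = ℚ.toℚᵘ-cancel-≤ (ℚᵘ.≤-respˡ-≃ (ℚᵘ.≃-sym (toℚᵘ-/1 (+ m)))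
  (ℚᵘ.≤-respʳ-≃ (ℚᵘ.≃-sym (toℚᵘ-/1 (+ n)))
    (ℚᵘ.*≤* (ℤ.*-monoʳ-≤-nonNeg (+ 1) (ℤ.+≤+ m≤n)))))

0≤ℕ→ℚ : ∀ n → 0ℚ ℚ.≤ ℕ→ℚ n
0≤ℕ→ℚ n = ℕ→ℚ-mono {0} {n} z≤n

ℕ→ℚ-*-1/ : ∀ d .{{_ : NonZero d}} → ℕ→ℚ d ℚ.* ((+ 1) ℚ./ d) ≡ 1ℚ
ℕ→ℚ-*-1/ (suc d) = ℚ.toℚᵘ-injective (ℚᵘ.≃-trans (ℚ.toℚᵘ-homo-* (ℕ→ℚ (suc d)) ((+ 1) ℚ./ suc d))
  (ℚᵘ.≃-trans (ℚᵘ.*-cong (toℚᵘ-/1 (+ suc d)) (ℚ.toℚᵘ-fromℚᵘ (ℚᵘ.mkℚᵘ (+ 1) d)))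
    (ℚᵘ.*≡* (cong +_ (trans (ℕ.*-identityʳ _) (trans (ℕ.*-identityʳ (suc d))
      (sym (trans (ℕ.*-identityˡ _) (ℕ.*-identityˡ (suc d))))))))))

*-mono-≤ : ∀ {a b c d} → 0ℚ ℚ.≤ b → 0ℚ ℚ.≤ c → a ℚ.≤ b → c ℚ.≤ d → a ℚ.* c ℚ.≤ b ℚ.* d
*-mono-≤ {b = b} {c} 0≤b 0≤c a≤b c≤d = ℚ.≤-trans
  (ℚ.*-monoʳ-≤-nonNeg c {{ℚ.nonNegative 0≤c}} a≤b)
  (ℚ.*-monoˡ-≤-nonNeg b {{ℚ.nonNegative 0≤b}} c≤d)

0≤* : ∀ {a b} → 0ℚ ℚ.≤ a → 0ℚ ℚ.≤ b → 0ℚ ℚ.≤ a ℚ.* b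
0≤* {a} {b} 0≤a 0≤b = subst (ℚ._≤ a ℚ.* b) (ℚ.*-zeroʳ a) (*-mono-≤ 0≤a ℚ.≤-refl ℚ.≤-refl 0≤b)

2^_ : ℕ → ℚ
2^ n = ℕ→ℚ (2 ℕ.^ n)

2^-½^ : ∀ n → 2^ n ℚ.* ½^ n ≡ 1ℚ
2^-½^ n = ℕ→ℚ-*-1/ (2 ℕ.^ n) {{ℕ.m^n≢0 2 n}}

2^-+ : ∀ m n → 2^ (m ℕ.+ n) ≡ 2^ m ℚ.* 2^ n
2^-+ m n = trans (cong ℕ→ℚ (ℕ.^-distribˡ-+-* 2 m n)) (ℕ→ℚ-* (2 ℕ.^ m) (2 ℕ.^ n))

½^-+ : ∀ m n → ½^ (m ℕ.+ n) ≡ ½^ m ℚ.* ½^ n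
½^-+ m n = begin
  h                                         ≡⟨ ℚ.*-identityʳ h ⟨
  h ℚ.* 1ℚ                                  ≡⟨ cong (h ℚ.*_) (cong₂ ℚ._*_ (2^-½^ m) (2^-½^ n)) ⟨
  h ℚ.* ((2^ m ℚ.* ½^ m) ℚ.* (2^ n ℚ.* ½^ n))
    ≡⟨ solve 5 (λ h a b c d → h :* ((a :* b) :* (c :* d)) := ((a :* c) :* h) :* (b :* d)) refl
         h (2^ m) (½^ m) (2^ n) (½^ n) ⟩
  ((2^ m ℚ.* 2^ n) ℚ.* h) ℚ.* (½^ m ℚ.* ½^ n)
    ≡⟨ cong (λ z → z ℚ.* h ℚ.* (½^ m ℚ.* ½^ n)) (2^-+ m n) ⟨
  (2^ (m ℕ.+ n) ℚ.* h) ℚ.* (½^ m ℚ.* ½^ n)  ≡⟨ cong (ℚ._* (½^ m ℚ.* ½^ n)) (2^-½^ (m ℕ.+ n)) ⟩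
  1ℚ ℚ.* (½^ m ℚ.* ½^ n)                    ≡⟨ ℚ.*-identityˡ _ ⟩
  ½^ m ℚ.* ½^ n ∎
  where
  open ≡-Reasoning
  h = ½^ (m ℕ.+ n)

½^-halves : ∀ n → ½^ suc n ℚ.+ ½^ suc n ≡ ½^ n
½^-halves n = trans (cong (λ z → z ℚ.+ z) (½^-+ 1 n))
  (trans (sym (ℚ.*-distribʳ-+ (½^ n) (½^ 1) (½^ 1))) (ℚ.*-identityˡ (½^ n)))

2^-½^-+ : ∀ m n → 2^ m ℚ.* ½^ (m ℕ.+ n) ≡ ½^ n
2^-½^-+ m n = trans (cong (2^ m ℚ.*_) (½^-+ m n)) (trans (sym (ℚ.*-assoc (2^ m) (½^ m) (½^ n)))
  (trans (cong (ℚ._* ½^ n) (2^-½^ m)) (ℚ.*-identityˡ (½^ n))))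

0<½^ : ∀ n → 0ℚ ℚ.< ½^ n
0<½^ zero    = ℚ.positive⁻¹ 1ℚ
0<½^ (suc n) = subst (0ℚ ℚ.<_) (sym (½^-+ 1 n)) (ℚ.*-monoʳ-<-pos ½ (0<½^ n))

0≤½^ : ∀ n → 0ℚ ℚ.≤ ½^ n
0≤½^ n = ℚ.<⇒≤ (0<½^ n)

½^≤1 : ∀ n → ½^ n ℚ.≤ 1ℚ
½^≤1 n = subst₂ ℚ._≤_ (ℚ.*-identityˡ (½^ n)) (2^-½^ n)
  (ℚ.*-monoʳ-≤-nonNeg (½^ n) {{ℚ.nonNegative (0≤½^ n)}} (ℕ→ℚ-mono (ℕ.m^n>0 2 n)))

½^-antimono : ∀ {m n} → m ℕ.≤ n → ½^ n ℚ.≤ ½^ m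
½^-antimono {m} {n} m≤n = subst₂ ℚ._≤_
  (trans (sym (½^-+ (n ℕ.∸ m) m)) (cong ½^_ (ℕ.m∸n+n≡m m≤n)))
  (ℚ.*-identityˡ (½^ m))
  (ℚ.*-monoʳ-≤-nonNeg (½^ m) {{ℚ.nonNegative (0≤½^ m)}} (½^≤1 (n ℕ.∸ m)))

-- If ε has denominator d, then ε ≥ 1/d ≥ 2 ^ (- d).
½^-archimedean : ∀ ε → 0ℚ ℚ.< ε → ∃[ n ] ½^ n ℚ.≤ ε
½^-archimedean ε 0<ε = d , subst₂ ℚ._≤_ (ℚ.*-identityˡ (½^ d)) ε-eq
    (ℚ.*-monoʳ-≤-nonNeg (½^ d) {{ℚ.nonNegative (0≤½^ d)}} 1≤ε2^d)
  where
  d = ℚ.↧ₙ ε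
  ε-eq : ε ℚ.* 2^ d ℚ.* ½^ d ≡ ε
  ε-eq = trans (ℚ.*-assoc ε (2^ d) (½^ d)) (trans (cong (ε ℚ.*_) (2^-½^ d)) (ℚ.*-identityʳ ε))
  1≤εd : ∀ ε → 0ℚ ℚ.< ε → 1ℚ ℚ.≤ ε ℚ.* ℕ→ℚ (ℚ.↧ₙ ε)
  1≤εd ε@(mkℚ (+ suc n) e _) _ = ℚ.toℚᵘ-cancel-≤ (ℚᵘ.≤-respʳ-≃
    (ℚᵘ.≃-sym (ℚᵘ.≃-trans (ℚ.toℚᵘ-homo-* ε (ℕ→ℚ (suc e)))
      (ℚᵘ.*-congˡ {ℚ.toℚᵘ ε} (toℚᵘ-/1 (+ suc e)))))
    (ℚᵘ.*≤* (ℤ.+≤+ (ℕ.≤-trans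
      (ℕ.≤-reflexive (trans (ℕ.*-identityˡ _) (ℕ.*-identityʳ (suc e))))
      (ℕ.≤-trans (ℕ.m≤n*m (suc e) (suc n)) (ℕ.≤-reflexive (sym (ℕ.*-identityʳ _))))))))
  1≤εd (mkℚ (+ 0) e _) (ℚ.*<* (ℤ.+<+ ()))
  1≤εd (mkℚ ℤ.-[1+ n ] e _) (ℚ.*<* ())
  1≤ε2^d : 1ℚ ℚ.≤ ε ℚ.* 2^ d
  1≤ε2^d = ℚ.≤-trans (1≤εd ε 0<ε)
    (*-mono-≤ (ℚ.<⇒≤ 0<ε) (0≤ℕ→ℚ d) (ℚ.≤-refl {ε}) (ℕ→ℚ-mono (ℕ.<⇒≤ (n<2^n d))))

-- Binary digits and partial sums.

digit : Fin 2 → ℚ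
digit c = ℕ→ℚ (toℕ c)

0≤digit : ∀ c → 0ℚ ℚ.≤ digit c
0≤digit c = 0≤ℕ→ℚ (toℕ c)

digit≤1 : ∀ c → digit c ℚ.≤ 1ℚ
digit≤1 zero       = ℕ→ℚ-mono {0} {1} z≤n
digit≤1 (suc zero) = ℚ.≤-refl

digit-complement : ∀ {c d} → c ≢ d → digit c ℚ.+ digit d ≡ 1ℚ
digit-complement {zero}     {zero}     c≢d = ⊥-elim (c≢d refl)
digit-complement {zero}     {suc zero} c≢d = refl
digit-complement {suc zero} {zero}     c≢d = refl
digit-complement {suc zero} {suc zero} c≢d = ⊥-elim (c≢d refl)

shift : ∀ {k} → ℕ → ωWord k → ωWord k
shift k w i = w (i ℕ.+ k)

partialSum-shift : ∀ w m n →
  partialSum w (n ℕ.+ m) ≡ partialSum w m ℚ.+ ½^ m ℚ.* partialSum (shift m w) n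
partialSum-shift w m zero = sym (trans (cong (partialSum w m ℚ.+_) (ℚ.*-zeroʳ (½^ m)))
  (ℚ.+-identityʳ (partialSum w m)))
partialSum-shift w m (suc n) = trans
  (cong₂ (λ s h → s ℚ.+ digit (w (n ℕ.+ m)) ℚ.* h) (partialSum-shift w m n) (½^-+ (suc n) m))
  (solve 5 (λ a h b d g → a :+ h :* b :+ d :* (g :* h) := a :+ h :* (b :+ d :* g)) refl
    (partialSum w m) (½^ m) (partialSum (shift m w) n) (digit (w (n ℕ.+ m))) (½^ suc n))

0≤partialSum : ∀ w n → 0ℚ ℚ.≤ partialSum w n
0≤partialSum w zero    = ℚ.≤-refl
0≤partialSum w (suc n) = ℚ.+-mono-≤ (0≤partialSum w n) (0≤* (0≤digit (w n)) (0≤½^ (suc n)))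

-- The extra term carries the induction: a new digit takes at most half of it and leaves the other
-- half.
partialSum+½^≤1 : ∀ w n → partialSum w n ℚ.+ ½^ n ℚ.≤ 1ℚ
partialSum+½^≤1 w zero    = ℚ.≤-refl
partialSum+½^≤1 w (suc n) = ℚ.≤-trans
  (ℚ.+-monoˡ-≤ h (ℚ.+-monoʳ-≤ (partialSum w n)
    (*-mono-≤ (0≤ℕ→ℚ 1) (0≤½^ (suc n)) (digit≤1 (w n)) ℚ.≤-refl)))
  (subst (ℚ._≤ 1ℚ)
    (trans (cong (partialSum w n ℚ.+_) (sym (½^-halves n)))
      (solve 2 (λ a h → a :+ (h :+ h) := a :+ con 1ℚ :* h :+ h) refl (partialSum w n) h))
    (partialSum+½^≤1 w n))
  where
  h = ½^ suc n

partialSum≤1 : ∀ w n → partialSum w n ℚ.≤ 1ℚ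
partialSum≤1 w n = ℚ.≤-trans
  (subst (ℚ._≤ partialSum w n ℚ.+ ½^ n) (ℚ.+-identityʳ _) (ℚ.+-monoʳ-≤ (partialSum w n) (0≤½^ n)))
  (partialSum+½^≤1 w n)

partialSum-cong : ∀ u v n → (∀ i → i ℕ.< n → u i ≡ v i) → partialSum u n ≡ partialSum v n
partialSum-cong u v zero    e = refl
partialSum-cong u v (suc n) e = cong₂ (λ s c → s ℚ.+ digit c ℚ.* ½^ suc n)
  (partialSum-cong u v n λ i i<n → e i (ℕ.m≤n⇒m≤1+n i<n)) (e n ℕ.≤-refl)

-- Complementary digits add up to 0.11...1 = 1 - 2 ^ (- n).
partialSum-complement : ∀ u v n → (∀ i → i ℕ.< n → u i ≢ v i) →
                        partialSum u n ℚ.+ partialSum v n ℚ.+ ½^ n ≡ 1ℚ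
partialSum-complement u v zero    e = refl
partialSum-complement u v (suc n) e = begin
  (a ℚ.+ digit (u n) ℚ.* h) ℚ.+ (b ℚ.+ digit (v n) ℚ.* h) ℚ.+ h
    ≡⟨ solve 5 (λ a b c d h → (a :+ c :* h) :+ (b :+ d :* h) :+ h :=
                  a :+ b :+ ((c :+ d) :* h :+ h)) refl a b (digit (u n)) (digit (v n)) h ⟩
  a ℚ.+ b ℚ.+ ((digit (u n) ℚ.+ digit (v n)) ℚ.* h ℚ.+ h)
    ≡⟨ cong (λ z → a ℚ.+ b ℚ.+ (z ℚ.* h ℚ.+ h)) (digit-complement (e n ℕ.≤-refl)) ⟩
  a ℚ.+ b ℚ.+ (1ℚ ℚ.* h ℚ.+ h)
    ≡⟨ cong (a ℚ.+ b ℚ.+_) (trans (cong (ℚ._+ h) (ℚ.*-identityˡ h)) (½^-halves n)) ⟩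
  a ℚ.+ b ℚ.+ ½^ n
    ≡⟨ partialSum-complement u v n (λ i i<n → e i (ℕ.m≤n⇒m≤1+n i<n)) ⟩
  1ℚ ∎
  where
  open ≡-Reasoning
  a = partialSum u n
  b = partialSum v n
  h = ½^ suc n

2^*partialSum-integral : ∀ w n → ∃[ z ] 2^ n ℚ.* partialSum w n ≡ ℕ→ℚ z
2^*partialSum-integral w zero = 0 , refl
2^*partialSum-integral w (suc n) with 2^*partialSum-integral w n
... | z , e = 2 ℕ.* z ℕ.+ toℕ (w n) , (begin
  2^ suc n ℚ.* (s ℚ.+ d ℚ.* ½^ suc n)
    ≡⟨ solve 4 (λ p s d h → p :* (s :+ d :* h) := p :* s :+ (p :* h) :* d) refl
         (2^ suc n) s d (½^ suc n) ⟩
  2^ suc n ℚ.* s ℚ.+ (2^ suc n ℚ.* ½^ suc n) ℚ.* d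
    ≡⟨ cong₂ ℚ._+_ (cong (ℚ._* s) (2^-+ 1 n))
         (trans (cong (ℚ._* d) (2^-½^ (suc n))) (ℚ.*-identityˡ d)) ⟩
  2^ 1 ℚ.* 2^ n ℚ.* s ℚ.+ d
    ≡⟨ cong (ℚ._+ d) (trans (ℚ.*-assoc (2^ 1) (2^ n) s) (cong (2^ 1 ℚ.*_) e)) ⟩
  2^ 1 ℚ.* ℕ→ℚ z ℚ.+ d
    ≡⟨ trans (ℕ→ℚ-+ (2 ℕ.* z) (toℕ (w n))) (cong (ℚ._+ d) (ℕ→ℚ-* 2 z)) ⟨
  ℕ→ℚ (2 ℕ.* z ℕ.+ toℕ (w n)) ∎)
  where
  open ≡-Reasoning
  s = partialSum w n
  d = digit (w n)

UnitInterval : ℚ → Set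
UnitInterval t = 0ℚ ℚ.≤ t × t ℚ.≤ 1ℚ

-- Multiplication by 2 ^ j moves `j` digits into the integer part. The next `L` digits are kept
-- exactly, to be compared between two shifts; the rest is only bounded.
2^*partialSum-tail : ∀ w j L N → L ℕ.+ j ℕ.≤ N → ∃₂ λ z t → UnitInterval t ×
  2^ j ℚ.* partialSum w N ≡ ℕ→ℚ z ℚ.+ (partialSum (shift j w) L ℚ.+ ½^ L ℚ.* t)
2^*partialSum-tail w j L N L+j≤N with 2^*partialSum-integral w j
... | z , e = z , t , (0≤partialSum w′ M , partialSum≤1 w′ M) , (begin
  2^ j ℚ.* partialSum w N
    ≡⟨ cong (λ n → 2^ j ℚ.* partialSum w n)
         (sym (trans (ℕ.+-assoc M L j) (ℕ.m∸n+n≡m L+j≤N))) ⟩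
  2^ j ℚ.* partialSum w ((M ℕ.+ L) ℕ.+ j)
    ≡⟨ cong (2^ j ℚ.*_) (partialSum-shift w j (M ℕ.+ L)) ⟩
  2^ j ℚ.* (partialSum w j ℚ.+ ½^ j ℚ.* r)
    ≡⟨ solve 4 (λ p a h b → p :* (a :+ h :* b) := p :* a :+ (p :* h) :* b) refl
         (2^ j) (partialSum w j) (½^ j) r ⟩
  2^ j ℚ.* partialSum w j ℚ.+ (2^ j ℚ.* ½^ j) ℚ.* r
    ≡⟨ cong₂ ℚ._+_ e (trans (cong (ℚ._* r) (2^-½^ j)) (ℚ.*-identityˡ r)) ⟩
  ℕ→ℚ z ℚ.+ r
    ≡⟨ cong (ℕ→ℚ z ℚ.+_) (partialSum-shift (shift j w) L M) ⟩
  ℕ→ℚ z ℚ.+ (partialSum (shift j w) L ℚ.+ ½^ L ℚ.* t) ∎)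
  where
  open ≡-Reasoning
  M = N ℕ.∸ (L ℕ.+ j)
  w′ = shift L (shift j w)
  t = partialSum w′ M
  r = partialSum (shift j w) (M ℕ.+ L)

∣∣≤ : ∀ {p b} → p ℚ.≤ b → ℚ.- p ℚ.≤ b → ℚ.∣ p ∣ ℚ.≤ b
∣∣≤ {p} p≤b -p≤b with ℚ.∣p∣≡p∨∣p∣≡-p p
... | inj₁ e = ℚ.≤-trans (ℚ.≤-reflexive e) p≤b
... | inj₂ e = ℚ.≤-trans (ℚ.≤-reflexive e) -p≤b

∣t-s∣≤1 : ∀ {s t} → UnitInterval s → UnitInterval t → ℚ.∣ t ℚ.- s ∣ ℚ.≤ 1ℚ
∣t-s∣≤1 {s} {t} (0≤s , s≤1) (0≤t , t≤1) = ∣∣≤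
  (ℚ.+-mono-≤ t≤1 (ℚ.neg-antimono-≤ 0≤s))
  (subst (ℚ._≤ 1ℚ) (solve 2 (λ s t → s :- t := :- (t :- s)) refl s t)
    (ℚ.+-mono-≤ s≤1 (ℚ.neg-antimono-≤ 0≤t)))

∣h[t-s]∣≤h : ∀ L {s t} → UnitInterval s → UnitInterval t → ℚ.∣ ½^ L ℚ.* (t ℚ.- s) ∣ ℚ.≤ ½^ L
∣h[t-s]∣≤h L {s} {t} us ut = subst₂ ℚ._≤_
  (trans (cong (ℚ._* ℚ.∣ t ℚ.- s ∣) (sym (ℚ.0≤p⇒∣p∣≡p (0≤½^ L))))
    (sym (ℚ.∣p*q∣≡∣p∣*∣q∣ (½^ L) (t ℚ.- s))))
  (ℚ.*-identityʳ (½^ L))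
  (ℚ.*-monoˡ-≤-nonNeg (½^ L) {{ℚ.nonNegative (0≤½^ L)}} (∣t-s∣≤1 us ut))

-- Multiples of partial sums close to integers.

NearInteger : ℚ → ℚ → Set
NearInteger r h = ∃[ z ] ℚ.∣ r ℚ.- z ℚ./ 1 ∣ ℚ.≤ h

-- For `K` = 2 ^ k and `m` = 2 ^ p - 1: the digits `d` common to both shifts cancel, leaving the
-- difference of the tails.
difference-remainder : ∀ {K m s y z d h t u} →
  K ℚ.* (m ℚ.+ 1ℚ) ℚ.* s ≡ y ℚ.+ (d ℚ.+ h ℚ.* t) → K ℚ.* s ≡ z ℚ.+ (d ℚ.+ h ℚ.* u) →
  K ℚ.* m ℚ.* s ℚ.- (y ℚ.- z) ≡ h ℚ.* (t ℚ.- u)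
difference-remainder {K} {m} {s} {y} {z} {d} {h} {t} {u} e₁ e₂ = begin
  K ℚ.* m ℚ.* s ℚ.- (y ℚ.- z)
    ≡⟨ solve 5 (λ p m s y z → p :* m :* s :- (y :- z) :=
         p :* (m :+ con 1ℚ) :* s :- p :* s :- (y :- z)) refl K m s y z ⟩
  K ℚ.* (m ℚ.+ 1ℚ) ℚ.* s ℚ.- K ℚ.* s ℚ.- (y ℚ.- z)
    ≡⟨ cong₂ (λ a b → a ℚ.- b ℚ.- (y ℚ.- z)) e₁ e₂ ⟩
  (y ℚ.+ (d ℚ.+ h ℚ.* t)) ℚ.- (z ℚ.+ (d ℚ.+ h ℚ.* u)) ℚ.- (y ℚ.- z)
    ≡⟨ solve 6 (λ y z d h t u → (y :+ (d :+ h :* t)) :- (z :+ (d :+ h :* u)) :- (y :- z) :=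
         h :* (t :- u)) refl y z d h t u ⟩
  h ℚ.* (t ℚ.- u) ∎
  where open ≡-Reasoning

-- For `K` = 2 ^ k and `m` = 2 ^ p: the complementary digits `d` and `e` sum to 1 - `h`. The
-- remainder h (t + u - 1) is written as a difference of two points of the unit interval, so that
-- `∣h[t-s]∣≤h` applies.
sum-remainder : ∀ {K m s y z d e h t u} → K ℚ.* m ℚ.* s ≡ y ℚ.+ (d ℚ.+ h ℚ.* t) →
  K ℚ.* s ≡ z ℚ.+ (e ℚ.+ h ℚ.* u) → e ℚ.+ d ℚ.+ h ≡ 1ℚ →
  K ℚ.* (m ℚ.+ 1ℚ) ℚ.* s ℚ.- (y ℚ.+ z ℚ.+ 1ℚ) ≡ h ℚ.* (t ℚ.- (1ℚ ℚ.- u))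
sum-remainder {K} {m} {s} {y} {z} {d} {e} {h} {t} {u} e₁ e₂ e₃ = begin
  K ℚ.* (m ℚ.+ 1ℚ) ℚ.* s ℚ.- (y ℚ.+ z ℚ.+ 1ℚ)
    ≡⟨ solve 5 (λ p m s y z → p :* (m :+ con 1ℚ) :* s :- (y :+ z :+ con 1ℚ) :=
         p :* m :* s :+ p :* s :- (y :+ z :+ con 1ℚ)) refl K m s y z ⟩
  K ℚ.* m ℚ.* s ℚ.+ K ℚ.* s ℚ.- (y ℚ.+ z ℚ.+ 1ℚ)
    ≡⟨ cong (λ o → K ℚ.* m ℚ.* s ℚ.+ K ℚ.* s ℚ.- (y ℚ.+ z ℚ.+ o)) e₃ ⟨
  K ℚ.* m ℚ.* s ℚ.+ K ℚ.* s ℚ.- (y ℚ.+ z ℚ.+ (e ℚ.+ d ℚ.+ h))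
    ≡⟨ cong (ℚ._- (y ℚ.+ z ℚ.+ (e ℚ.+ d ℚ.+ h))) (cong₂ ℚ._+_ e₁ e₂) ⟩
  y ℚ.+ (d ℚ.+ h ℚ.* t) ℚ.+ (z ℚ.+ (e ℚ.+ h ℚ.* u)) ℚ.- (y ℚ.+ z ℚ.+ (e ℚ.+ d ℚ.+ h))
    ≡⟨ solve 7 (λ y z d e h t u → y :+ (d :+ h :* t) :+ (z :+ (e :+ h :* u)) :-
         (y :+ z :+ (e :+ d :+ h)) := h :* (t :- (con 1ℚ :- u))) refl y z d e h t u ⟩
  h ℚ.* (t ℚ.- (1ℚ ℚ.- u)) ∎
  where open ≡-Reasoning

module _ (w : ωWord 2) (k p L N : ℕ) (N≥ : L ℕ.+ (p ℕ.+ k) ℕ.≤ N) where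

  private
    s = partialSum w N

    N≥′ : L ℕ.+ k ℕ.≤ N
    N≥′ = ℕ.≤-trans (ℕ.+-monoʳ-≤ L (ℕ.m≤n+m k p)) N≥

    2^+ : 2^ (p ℕ.+ k) ≡ 2^ k ℚ.* 2^ p
    2^+ = trans (2^-+ p k) (ℚ.*-comm (2^ p) (2^ k))

  agree-nearInteger : Agree w k p L →
    NearInteger (ℕ→ℚ (2 ℕ.^ k ℕ.* (2 ℕ.^ p ℕ.∸ 1)) ℚ.* partialSum w N) (½^ L)
  agree-nearInteger agree =
    let z₁ , t₁ , u₁ , e₁ = 2^*partialSum-tail w (p ℕ.+ k) L N N≥
        z₂ , t₂ , u₂ , e₂ = 2^*partialSum-tail w k L N N≥′
    in (+ z₁) ℤ.- (+ z₂) ,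
       subst (λ r → ℚ.∣ r ∣ ℚ.≤ ½^ L) (sym (eq z₁ t₁ e₁ z₂ t₂ e₂)) (∣h[t-s]∣≤h L u₂ u₁)
    where
    m = 2 ℕ.^ p ℕ.∸ 1
    D = partialSum (shift k w) L

    m+1 : ℕ→ℚ m ℚ.+ 1ℚ ≡ 2^ p
    m+1 = trans (sym (ℕ→ℚ-+ m 1)) (cong ℕ→ℚ (ℕ.m∸n+n≡m (ℕ.m^n>0 2 p)))

    eq : ∀ z₁ t₁ → 2^ (p ℕ.+ k) ℚ.* s ≡
           ℕ→ℚ z₁ ℚ.+ (partialSum (shift (p ℕ.+ k) w) L ℚ.+ ½^ L ℚ.* t₁) →
         ∀ z₂ t₂ → 2^ k ℚ.* s ≡ ℕ→ℚ z₂ ℚ.+ (D ℚ.+ ½^ L ℚ.* t₂) →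
         ℕ→ℚ (2 ℕ.^ k ℕ.* m) ℚ.* s ℚ.- ((+ z₁) ℤ.- (+ z₂)) ℚ./ 1 ≡ ½^ L ℚ.* (t₁ ℚ.- t₂)
    eq z₁ t₁ e₁ z₂ t₂ e₂ = trans
      (cong₂ (λ q z → q ℚ.* s ℚ.- z) (ℕ→ℚ-* (2 ℕ.^ k) m)
        (trans (/1-+ (+ z₁) (ℤ.- (+ z₂))) (cong (ℕ→ℚ z₁ ℚ.+_) (/1-neg (+ z₂)))))
      (difference-remainder {2^ k} {ℕ→ℚ m} {s} {ℕ→ℚ z₁} {ℕ→ℚ z₂} {D} {½^ L} {t₁} {t₂}
        (trans (cong (ℚ._* s) (trans (cong (2^ k ℚ.*_) m+1) (sym 2^+)))
          (trans e₁ (cong (λ d → ℕ→ℚ z₁ ℚ.+ (d ℚ.+ ½^ L ℚ.* t₁))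
            (sym (partialSum-cong (shift k w) (shift (p ℕ.+ k) w) L (agree .at))))))
        e₂)

  differ-nearInteger : Differ w k p L →
    NearInteger (ℕ→ℚ (2 ℕ.^ k ℕ.* (2 ℕ.^ p ℕ.+ 1)) ℚ.* partialSum w N) (½^ L)
  differ-nearInteger differ =
    let z₁ , t₁ , u₁ , e₁ = 2^*partialSum-tail w (p ℕ.+ k) L N N≥
        z₂ , t₂ , u₂ , e₂ = 2^*partialSum-tail w k L N N≥′
    in (+ (z₁ ℕ.+ z₂ ℕ.+ 1)) ,
       subst (λ r → ℚ.∣ r ∣ ℚ.≤ ½^ L) (sym (eq z₁ t₁ e₁ z₂ t₂ e₂)) (∣h[t-s]∣≤h L (reflect u₂) u₁)
    where
    D₁ = partialSum (shift (p ℕ.+ k) w) L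
    D₂ = partialSum (shift k w) L

    reflect : ∀ {t} → UnitInterval t → UnitInterval (1ℚ ℚ.- t)
    reflect (0≤t , t≤1) =
      ℚ.+-monoʳ-≤ 1ℚ (ℚ.neg-antimono-≤ t≤1) , ℚ.+-monoʳ-≤ 1ℚ (ℚ.neg-antimono-≤ 0≤t)

    eq : ∀ z₁ t₁ → 2^ (p ℕ.+ k) ℚ.* s ≡ ℕ→ℚ z₁ ℚ.+ (D₁ ℚ.+ ½^ L ℚ.* t₁) →
         ∀ z₂ t₂ → 2^ k ℚ.* s ≡ ℕ→ℚ z₂ ℚ.+ (D₂ ℚ.+ ½^ L ℚ.* t₂) →
         ℕ→ℚ (2 ℕ.^ k ℕ.* (2 ℕ.^ p ℕ.+ 1)) ℚ.* s ℚ.- ℕ→ℚ (z₁ ℕ.+ z₂ ℕ.+ 1) ≡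
         ½^ L ℚ.* (t₁ ℚ.- (1ℚ ℚ.- t₂))
    eq z₁ t₁ e₁ z₂ t₂ e₂ = trans
      (cong₂ (λ q z → q ℚ.* s ℚ.- z)
        (trans (ℕ→ℚ-* (2 ℕ.^ k) (2 ℕ.^ p ℕ.+ 1)) (cong (2^ k ℚ.*_) (ℕ→ℚ-+ (2 ℕ.^ p) 1)))
        (trans (ℕ→ℚ-+ (z₁ ℕ.+ z₂) 1) (cong (ℚ._+ 1ℚ) (ℕ→ℚ-+ z₁ z₂))))
      (sum-remainder {2^ k} {2^ p} {s} {ℕ→ℚ z₁} {ℕ→ℚ z₂} {D₁} {D₂} {½^ L} {t₁} {t₂}
        (trans (cong (ℚ._* s) (sym 2^+)) e₁) e₂
        (partialSum-complement (shift k w) (shift (p ℕ.+ k) w) L (differ .at)))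

-- The 2-adic absolute value and the Littlewood terms.

ν₂≤-greatest : ∀ b q {k} → k ℕ.≤ b → 2 ℕ.^ k ∣ q → k ℕ.≤ ν₂≤ b q
ν₂≤-greatest zero    q z≤n  _ = z≤n
ν₂≤-greatest (suc b) q {k} k≤ d with 2 ℕ.^ suc b ∣? q
... | yes _ = k≤
... | no ¬d = ν₂≤-greatest b q (ℕ.≤-pred (ℕ.≤∧≢⇒< k≤ λ { refl → ¬d d })) d

∣∣₂-≤ : ∀ q .{{_ : NonZero q}} k → 2 ℕ.^ k ∣ q → k ℕ.≤ q → ∣ q ∣₂ ℚ.≤ ½^ k
∣∣₂-≤ q k d k≤q = ½^-antimono (ν₂≤-greatest q q k≤q d)

0≤distℤ : ∀ r → 0ℚ ℚ.≤ distℤ r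
0≤distℤ r = let z , e = distℤ-attained r in subst (0ℚ ℚ.≤_) (sym e) (ℚ.0≤∣p∣ _)

-- Carries the estimate from a partial sum `s` to a nearby rational approximation `r` of x.
distℤ-perturbed : ∀ {Q s r h δ} → 0ℚ ℚ.≤ Q → NearInteger (Q ℚ.* s) h → ℚ.∣ s ℚ.- r ∣ ℚ.≤ δ →
                  distℤ (Q ℚ.* r) ℚ.≤ h ℚ.+ Q ℚ.* δ
distℤ-perturbed {Q} {s} {r} {h} {δ} 0≤Q (z , near) close = begin
  distℤ (Q ℚ.* r)                                       ≤⟨ distℤ-≤ (Q ℚ.* r) z ⟩
  ℚ.∣ Q ℚ.* r ℚ.- Z ∣                                   ≡⟨ cong ℚ.∣_∣ (split Q s r Z) ⟩
  ℚ.∣ (Q ℚ.* s ℚ.- Z) ℚ.- Q ℚ.* (s ℚ.- r) ∣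
    ≤⟨ ℚ.∣p-q∣≤∣p∣+∣q∣ (Q ℚ.* s ℚ.- Z) (Q ℚ.* (s ℚ.- r)) ⟩
  ℚ.∣ Q ℚ.* s ℚ.- Z ∣ ℚ.+ ℚ.∣ Q ℚ.* (s ℚ.- r) ∣
    ≡⟨ cong (ℚ.∣ Q ℚ.* s ℚ.- Z ∣ ℚ.+_) (trans (ℚ.∣p*q∣≡∣p∣*∣q∣ Q (s ℚ.- r))
         (cong (ℚ._* ℚ.∣ s ℚ.- r ∣) (ℚ.0≤p⇒∣p∣≡p 0≤Q))) ⟩
  ℚ.∣ Q ℚ.* s ℚ.- Z ∣ ℚ.+ Q ℚ.* ℚ.∣ s ℚ.- r ∣
    ≤⟨ ℚ.+-mono-≤ near (ℚ.*-monoˡ-≤-nonNeg Q {{ℚ.nonNegative 0≤Q}} close) ⟩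
  h ℚ.+ Q ℚ.* δ ∎
  where
  open ℚ.≤-Reasoning
  Z = z ℚ./ 1
  split : ∀ Q s r Z → Q ℚ.* r ℚ.- Z ≡ (Q ℚ.* s ℚ.- Z) ℚ.- Q ℚ.* (s ℚ.- r)
  split = solve 4 (λ Q s r Z → Q :* r :- Z := (Q :* s :- Z) :- Q :* (s :- r)) refl

-- q = 2 ^ k · m makes q · |q|₂ ≤ m ≤ 2 ^ (1 + p), against an error of 2 ^ (- (p + K)).
record Approximation (w : ωWord 2) (K N : ℕ) : Set where
  field
    k p m : ℕ
    N≤k   : N ℕ.≤ k
    1≤m   : 1 ℕ.≤ m
    m≤    : m ℕ.≤ 2 ℕ.^ (1 ℕ.+ p)
    near  : ∀ n → p ℕ.+ K ℕ.+ (p ℕ.+ k) ℕ.≤ n →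
            NearInteger (ℕ→ℚ (2 ℕ.^ k ℕ.* m) ℚ.* partialSum w n) (½^ (p ℕ.+ K))

-- Giving up `N` comparisons moves the start on by `N`. This makes the exponent of 2 in q at least
-- `N`, which yields arbitrarily large q from a single repetition.
correlated-drop : ∀ {R w k p L} N → Correlated R w k p (L ℕ.+ N) → Correlated R w (N ℕ.+ k) p L
correlated-drop {R} {w} {k} {p} N rs .at i i<L = subst₂ (λ m n → R (w m) (w n))
  (ℕ.+-assoc i N k)
  (trans (ℕ.+-assoc i N (p ℕ.+ k)) (cong (i ℕ.+_)
    (trans (sym (ℕ.+-assoc N p k)) (trans (cong (ℕ._+ k) (ℕ.+-comm N p)) (ℕ.+-assoc p N k)))))
  (rs .at (i ℕ.+ N) (ℕ.+-monoˡ-< N i<L))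

repetitive-approximation : ∀ {w} → Repetitive w → ∀ K N → Approximation w K N
repetitive-approximation {w} rep K N with rep (K ℕ.+ N)
... | k , p , 1≤p , inj₁ agree = record
  { k = N ℕ.+ k ; p = p ; m = 2 ℕ.^ p ℕ.∸ 1
  ; N≤k = ℕ.m≤m+n N k
  -- From `1 ≤ p` it follows that 2 ^ p > 1.
  ; 1≤m = ℕ.m<n⇒0<n∸m (ℕ.≤-<-trans 1≤p (n<2^n p))
  ; m≤ = ℕ.≤-trans (ℕ.m∸n≤m _ 1) (ℕ.m≤m+n (2 ℕ.^ p) _)
  ; near = λ n n≥ → agree-nearInteger w (N ℕ.+ k) p (p ℕ.+ K) n n≥
      (correlated-drop N (subst (Agree w k p) (sym (ℕ.+-assoc p K N)) agree))
  }
... | k , p , 1≤p , inj₂ differ = record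
  { k = N ℕ.+ k ; p = p ; m = 2 ℕ.^ p ℕ.+ 1
  ; N≤k = ℕ.m≤m+n N k
  ; 1≤m = ℕ.m≤n+m 1 _
  ; m≤ = ℕ.+-monoʳ-≤ (2 ℕ.^ p) (ℕ.≤-trans (ℕ.m^n>0 2 p) (ℕ.m≤m+n _ 0))
  ; near = λ n n≥ → differ-nearInteger w (N ℕ.+ k) p (p ℕ.+ K) n n≥
      (correlated-drop N (subst (Differ w k p) (sym (ℕ.+-assoc p K N)) differ))
  }

-- As 2 ^ k divides `q`, |q|₂ ≤ 2 ^ (- k). The search bound in `∣ q ∣₂` is large enough because k <
-- 2 ^ k ≤ q.
weight-≤ : ∀ k m q .{{_ : NonZero q}} → 1 ℕ.≤ m → q ≡ 2 ℕ.^ k ℕ.* m → ℕ→ℚ q ℚ.* ∣ q ∣₂ ℚ.≤ ℕ→ℚ m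
weight-≤ k m q 1≤m q≡ = begin
  ℕ→ℚ q ℚ.* ∣ q ∣₂
    ≤⟨ ℚ.*-monoˡ-≤-nonNeg (ℕ→ℚ q) {{ℚ.nonNegative (0≤ℕ→ℚ q)}} (∣∣₂-≤ q k 2^k∣q k≤q) ⟩
  ℕ→ℚ q ℚ.* ½^ k
    ≡⟨ cong (ℚ._* ½^ k) (trans (cong ℕ→ℚ q≡) (ℕ→ℚ-* (2 ℕ.^ k) m)) ⟩
  2^ k ℚ.* ℕ→ℚ m ℚ.* ½^ k
    ≡⟨ solve 3 (λ a b c → a :* b :* c := (a :* c) :* b) refl (2^ k) (ℕ→ℚ m) (½^ k) ⟩
  2^ k ℚ.* ½^ k ℚ.* ℕ→ℚ m
    ≡⟨ trans (cong (ℚ._* ℕ→ℚ m) (2^-½^ k)) (ℚ.*-identityˡ (ℕ→ℚ m)) ⟩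
  ℕ→ℚ m ∎
  where
  open ℚ.≤-Reasoning
  2^k∣q : 2 ℕ.^ k ∣ q
  2^k∣q = subst (2 ℕ.^ k ∣_) (sym q≡) (m∣m*n m)
  k≤q : k ℕ.≤ q
  k≤q = subst (k ℕ.≤_) (sym q≡) (ℕ.≤-trans (ℕ.<⇒≤ (n<2^n k))
    (subst (ℕ._≤ 2 ℕ.^ k ℕ.* m) (ℕ.*-identityʳ _) (ℕ.*-monoʳ-≤ (2 ℕ.^ k) 1≤m)))

-- The exponents are chosen to cancel m ≤ 2 ^ (1 + p) and 2 ^ k m ≤ 2 ^ (k + 1 + p), so that the
-- distance to the integer and the truncation of x contribute at most 2 ^ (- K) each.
error-≤ : ∀ k p m K → m ℕ.≤ 2 ℕ.^ (1 ℕ.+ p) →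
  ℕ→ℚ m ℚ.* (½^ (p ℕ.+ suc K) ℚ.+
    ℕ→ℚ (2 ℕ.^ k ℕ.* m) ℚ.* ½^ ((1 ℕ.+ p) ℕ.+ ((k ℕ.+ (1 ℕ.+ p)) ℕ.+ K))) ℚ.≤ ½^ K ℚ.+ ½^ K
error-≤ k p m K m≤ = begin
  ℕ→ℚ m ℚ.* (½^ (p ℕ.+ suc K) ℚ.+ ℕ→ℚ (2 ℕ.^ k ℕ.* m) ℚ.* δ)
    ≤⟨ *-mono-≤ {ℕ→ℚ m} {2^ (1 ℕ.+ p)} {½^ (p ℕ.+ suc K) ℚ.+ Q ℚ.* δ}
         (0≤ℕ→ℚ (2 ℕ.^ (1 ℕ.+ p)))
         (ℚ.+-mono-≤ (0≤½^ (p ℕ.+ suc K)) (0≤* {Q} (0≤ℕ→ℚ (2 ℕ.^ k ℕ.* m)) (0≤½^ e)))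
         (ℕ→ℚ-mono {m} m≤)
         (ℚ.+-mono-≤ (ℚ.≤-reflexive (cong ½^_ (ℕ.+-suc p K)))
           (ℚ.*-monoʳ-≤-nonNeg δ {{ℚ.nonNegative (0≤½^ e)}}
             (ℕ→ℚ-mono {2 ℕ.^ k ℕ.* m} {2 ℕ.^ k ℕ.* 2 ℕ.^ (1 ℕ.+ p)}
               (ℕ.*-monoʳ-≤ (2 ℕ.^ k) m≤)))) ⟩
  2^ (1 ℕ.+ p) ℚ.* (½^ (1 ℕ.+ p ℕ.+ K) ℚ.+ ℕ→ℚ (2 ℕ.^ k ℕ.* 2 ℕ.^ (1 ℕ.+ p)) ℚ.* δ)
    ≡⟨ cong (λ n → 2^ (1 ℕ.+ p) ℚ.* (½^ (1 ℕ.+ p ℕ.+ K) ℚ.+ ℕ→ℚ n ℚ.* δ))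
         (sym (ℕ.^-distribˡ-+-* 2 k (1 ℕ.+ p))) ⟩
  2^ (1 ℕ.+ p) ℚ.* (½^ (1 ℕ.+ p ℕ.+ K) ℚ.+ 2^ (k ℕ.+ (1 ℕ.+ p)) ℚ.* δ)
    ≡⟨ expand (2^ (1 ℕ.+ p)) (½^ (1 ℕ.+ p ℕ.+ K)) (2^ (k ℕ.+ (1 ℕ.+ p))) δ ⟩
  2^ (1 ℕ.+ p) ℚ.* ½^ (1 ℕ.+ p ℕ.+ K) ℚ.+ 2^ (k ℕ.+ (1 ℕ.+ p)) ℚ.* (2^ (1 ℕ.+ p) ℚ.* δ)
    ≡⟨ cong₂ ℚ._+_ (2^-½^-+ (1 ℕ.+ p) K)
         (trans (cong (2^ (k ℕ.+ (1 ℕ.+ p)) ℚ.*_) (2^-½^-+ (1 ℕ.+ p) ((k ℕ.+ (1 ℕ.+ p)) ℕ.+ K)))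
                (2^-½^-+ (k ℕ.+ (1 ℕ.+ p)) K)) ⟩
  ½^ K ℚ.+ ½^ K ∎
  where
  open ℚ.≤-Reasoning
  e = (1 ℕ.+ p) ℕ.+ ((k ℕ.+ (1 ℕ.+ p)) ℕ.+ K)
  δ = ½^ e
  Q = ℕ→ℚ (2 ℕ.^ k ℕ.* m)
  expand : ∀ a b c d → a ℚ.* (b ℚ.+ c ℚ.* d) ≡ a ℚ.* b ℚ.+ c ℚ.* (a ℚ.* d)
  expand = solve 4 (λ a b c d → a :* (b :+ c :* d) := a :* b :+ c :* (a :* d)) refl

expansion-close : ∀ {w x} → w IsBase2ExpansionOf x → ∀ δ → 0ℚ ℚ.< δ → ∀ n₀ →
  ∃₂ λ n M → n₀ ℕ.≤ n × (∀ i → M ℕ.≤ i → ℚ.∣ partialSum w n ℚ.- seq x i ∣ ℚ.≤ δ)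
expansion-close {w} {x} exp δ 0<δ n₀ =
  let N , h = exp δ 0<δ
      ε , 0<ε , M , close = h (N ℕ.+ n₀) (ℕ.m≤m+n N n₀)
  in N ℕ.+ n₀ , M , ℕ.m≤n+m n₀ N , λ i M≤i →
       bound (partialSum w (N ℕ.+ n₀)) (seq x i) ε 0<ε (close i M≤i)
  where
  -- A term of a difference of reals unfolds to `s + (- 1) * r`; the margin `ε` of the strict
  -- inequality is dropped.
  bound : ∀ s r ε → 0ℚ ℚ.< ε → ℚ.∣ s ℚ.+ (ℚ.- 1ℚ) ℚ.* r ∣ ℚ.+ ε ℚ.≤ δ → ℚ.∣ s ℚ.- r ∣ ℚ.≤ δ
  bound s r ε 0<ε le = ℚ.≤-trans
    (subst (ℚ._≤ ℚ.∣ s ℚ.- r ∣ ℚ.+ ε) (ℚ.+-identityʳ _) (ℚ.+-monoʳ-≤ ℚ.∣ s ℚ.- r ∣ (ℚ.<⇒≤ 0<ε)))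
    (subst (λ z → ℚ.∣ s ℚ.+ z ∣ ℚ.+ ε ℚ.≤ δ)
      (trans (sym (ℚ.neg-distribˡ-* 1ℚ r)) (cong ℚ.-_ (ℚ.*-identityˡ r))) le)

0≤weight : ∀ q .{{_ : NonZero q}} → 0ℚ ℚ.≤ ℕ→ℚ q ℚ.* ∣ q ∣₂
0≤weight q = 0≤* (0≤ℕ→ℚ q) (0≤½^ (ν₂≤ q q))

-- Here `q` is a variable tied to 2 ^ k m by an equation, since the enumeration presents it as the
-- successor of its predecessor.
littlewoodTerm-eventually-≤ : ∀ {w x} → w IsBase2ExpansionOf x →
  ∀ {K N} (A : Approximation w (suc K) N) → let open Approximation A in
  ∀ q .{{_ : NonZero q}} → q ≡ 2 ℕ.^ k ℕ.* m →
  ∃[ M ] (∀ i → M ℕ.≤ i → seq (littlewoodTerm x q) i ℚ.≤ ½^ K ℚ.+ ½^ K)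
littlewoodTerm-eventually-≤ {w} {x} exp {K} A q q≡ =
  let n , M , n≥ , close = expansion-close {w} {x} exp (½^ e) (0<½^ e) (p ℕ.+ suc K ℕ.+ (p ℕ.+ k))
  in M , λ i M≤i → ℚ.≤-trans
       (*-mono-≤ (0≤ℕ→ℚ m) (0≤distℤ (ℕ→ℚ q ℚ.* seq x i)) (weight-≤ k m q 1≤m q≡)
         (distℤ-perturbed {ℕ→ℚ q} {partialSum w n} {seq x i} (0≤ℕ→ℚ q)
           (subst (λ z → NearInteger (ℕ→ℚ z ℚ.* partialSum w n) (½^ (p ℕ.+ suc K)))
             (sym q≡) (near n n≥))
           (close i M≤i)))
       (subst (λ z → ℕ→ℚ m ℚ.* (½^ (p ℕ.+ suc K) ℚ.+ ℕ→ℚ z ℚ.* ½^ e) ℚ.≤ ½^ K ℚ.+ ½^ K) (sym q≡)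
         (error-≤ k p m K m≤))
  where
  open Approximation A
  e = (1 ℕ.+ p) ℕ.+ ((k ℕ.+ (1 ℕ.+ p)) ℕ.+ K)

repetitive-littlewood : ∀ {w x} → w IsBase2ExpansionOf x → Repetitive w → SatisfiesTwoAdicLittlewood x
repetitive-littlewood {w} {x} exp rep = lower , upper
  where
  lower : ∀ ε → 0ℚ ℚ.< ε → ∃[ N ] (∀ n → N ℕ.≤ n → 0ℝ - fromℚ ε < littlewoodTerm x (suc n))
  -- The terms are nonnegative, so `ε` itself is a margin for the strict inequality.
  lower ε 0<ε = 0 , λ n _ → ε , 0<ε , 0 , λ i _ →
    subst (ℚ._≤ seq (littlewoodTerm x (suc n)) i) (sym (cancel ε))
      (0≤* (0≤weight (suc n)) (0≤distℤ (ℕ→ℚ (suc n) ℚ.* seq x i)))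
    where
    cancel : ∀ ε → 0ℚ ℚ.+ (ℚ.- 1ℚ) ℚ.* ε ℚ.+ ε ≡ 0ℚ
    cancel = solve 1 (λ ε → con 0ℚ :+ (:- con 1ℚ) :* ε :+ ε := con 0ℚ) refl

  upper : ∀ ε → 0ℚ ℚ.< ε → ∀ N → ∃[ n ] (N ℕ.≤ n × littlewoodTerm x (suc n) < 0ℝ + fromℚ ε)
  upper ε 0<ε N =
    let J , ½^J≤ε = ½^-archimedean ε 0<ε
        -- The term is then at most 2 · 2 ^ (- (2 + J)) = 2 ^ (- (1 + J)). An equal margin for
        -- strictness brings the total to 2 ^ (- J) ≤ ε.
        A = repetitive-approximation rep (3 ℕ.+ J) N
        open Approximation A
        q = 2 ℕ.^ k ℕ.* m
        2^k≤q : 2 ℕ.^ k ℕ.≤ q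
        2^k≤q = subst (ℕ._≤ q) (ℕ.*-identityʳ _) (ℕ.*-monoʳ-≤ (2 ℕ.^ k) 1≤m)
        N<q : N ℕ.< q
        N<q = ℕ.≤-<-trans N≤k (ℕ.<-≤-trans (n<2^n k) 2^k≤q)
        1+[q-1]≡q : suc (ℕ.pred q) ≡ q
        1+[q-1]≡q = ℕ.suc-pred q {{ℕ.>-nonZero (ℕ.≤-<-trans z≤n N<q)}}
        M , bound = littlewoodTerm-eventually-≤ {w} {x} exp A (suc (ℕ.pred q)) 1+[q-1]≡q
    in ℕ.pred q , ℕ.<⇒≤pred N<q , ½^ (1 ℕ.+ J) , 0<½^ (1 ℕ.+ J) , M , λ i M≤i →
         ℚ.≤-trans (ℚ.+-monoˡ-≤ (½^ (1 ℕ.+ J)) (bound i M≤i))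
           (ℚ.≤-trans (ℚ.≤-reflexive
               (trans (cong (ℚ._+ ½^ (1 ℕ.+ J)) (½^-halves (1 ℕ.+ J))) (½^-halves J)))
             (ℚ.≤-trans ½^J≤ε (ℚ.≤-reflexive (sym (ℚ.+-identityˡ ε)))))

theorem2p11 : (x : ℝ) → 0ℝ ≤ x → x ≤ 1ℝ →
    (w : ωWord 2) → w IsBase2ExpansionOf x → PureMorphic w →
    SatisfiesTwoAdicLittlewood x
theorem2p11 x _ _ w exp pure = repetitive-littlewood {w} {x} exp (pureMorphic-repetitive pure)
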